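{- Let $(a_m)_{m\ge 1}$ be an arbitrary sequence of complex numbers, let $t$ be a complex number with $t\neq 0$ and $t\neq 1$, and let $n$ be a positive integer. Then $$\sum_{\pi\in P(n)} t^{k(\pi)-1}\left(\frac{t-1}{t}\right)^{Q(\pi)-1}\sum_{j=1}^{s(\pi)} a_{l(\pi)-s(\pi)+j}=\sum_{d\mid n} t^{d}\left(\frac{a_1}{t}+\frac{a_2}{t^2}+\cdots+\frac{a_d}{t^d}\right),$$ where the sum on the right is over all positive divisors $d$ of $n$.
   Context: A partition of a positive integer $n$ is a sequence $\pi=(k_1,k_2,\dots)$ of non-negative integers, only finitely many nonzero, with $n=\sum_{j\ge1} j k_j$; the integer $k_j$ is the multiplicity of the part $j$, and the parts of $\pi$ are the $j$ with $k_j>0$. $P(n)$ denotes the set of all partitions of $n$. For $\pi\in P(n)$: $k(\pi)=\sum_j k_j$ is the total number of parts (counted with multiplicity), $Q(\pi)=\#\{j: k_j>0\}$ is the number of distinct parts, $s(\pi)$ is the smallest part, and $l(\pi)$ is the largest part. -}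

module Defs where

open import Algebra.Bundles using (CommutativeRing)
open import Algebra.Structures using (IsCommutativeRing)
open import Data.Empty using (⊥-elim)
open import Data.Fin.Base as Fin using (Fin; toℕ)
open import Data.List.Base using (List; []; _∷_; map; filter; foldr; length; upTo; allFin; cartesianProductWith)
open import Data.List.Extrema.Nat using (min; max)
open import Data.List.Membership.Propositional using (_∈_)
open import Data.List.Membership.Propositional.Properties
  using (∈-filter⁺; ∈-filter⁻; ∈-upTo⁺; ∈-map⁺; ∈-allFin; ∈-cartesianProductWith⁺)
open import Data.List.Relation.Unary.Any using (here; there)
open import Data.List.Relation.Unary.Unique.Propositional using (Unique)
import Data.List.Relation.Unary.Unique.Propositional.Properties as Unique
open import Data.List.Relation.Unary.AllPairs using ([]; _∷_)
open import Data.List.Relation.Unary.All using ([])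
open import Data.Nat.Base as ℕ using (ℕ; zero; suc)
open import Data.Nat.Divisibility using (_∣?_)
open import Data.Nat.ListAction using (sum)
import Data.Nat.Properties as ℕ
open import Data.Product.Base using (∃; _×_; _,_; proj₁; proj₂)
open import Data.Rational.Base as ℚ using (ℚ; 0ℚ; 1ℚ; ½; ∣_∣; _<_; _≤_)
import Data.Rational.Properties as ℚ
open import Data.Rational.Solver using (module +-*-Solver)
open +-*-Solver using (solve; _:=_; _:+_; _:*_; _:-_; :-_; con)
open import Data.Sum.Base using (inj₁; inj₂)
open import Data.Vec.Base as Vec using (Vec; lookup)
import Data.Vec.Properties as Vec
open import Function.Base using (_∘_)
open import Relation.Binary.PropositionalEquality
  using (_≡_; refl; sym; trans; cong; cong₂; subst)
open import Relation.Binary.Structures using (IsEquivalence)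
open import Relation.Nullary using (¬_; yes; no)

Eventually : (ℕ → Set) → Set
Eventually P = ∃ λ N → ∀ {n} → N ℕ.≤ n → P n

Eventually₂ : (ℕ → ℕ → Set) → Set
Eventually₂ P = ∃ λ N → ∀ {m n} → N ℕ.≤ m → N ℕ.≤ n → P m n

IsCauchy : (ℕ → ℚ) → Set
IsCauchy x = ∀ {ε} → 0ℚ < ε → Eventually₂ λ m n → ∣ x m ℚ.- x n ∣ < ε

-- Real numbers are Cauchy sequences of rationals, up to null sequences (_≈ᴿ_).
record ℝ : Set where
  constructor mkℝ
  field
    seq    : ℕ → ℚ
    cauchy : IsCauchy seq

open ℝ

infix 4 _≈ᴿ_

record _≈ᴿ_ (x y : ℝ) : Set where
  constructor mk≈ᴿ
  field
    close : ∀ {ε} → 0ℚ < ε → Eventually λ n → ∣ seq x n ℚ.- seq y n ∣ < ε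

open _≈ᴿ_

-- The constructively meaningful form of "x ≠ 0".
AwayFrom0 : ℝ → Set
AwayFrom0 x = ∃ λ ε → 0ℚ < ε × Eventually λ n → ε ≤ ∣ seq x n ∣

private opaque
  0<½* : ∀ {ε} → 0ℚ < ε → 0ℚ < ½ ℚ.* ε
  0<½* {ε} 0<ε = subst (_< ½ ℚ.* ε) (ℚ.*-zeroʳ ½) (ℚ.*-monoʳ-<-pos ½ 0<ε)

  ½+½ : ∀ ε → ½ ℚ.* ε ℚ.+ ½ ℚ.* ε ≡ ε
  ½+½ = solve 1 (λ e → con ½ :* e :+ con ½ :* e := e) refl

  0<* : ∀ {p q} → 0ℚ < p → 0ℚ < q → 0ℚ < p ℚ.* q
  0<* {p} {q} 0<p 0<q = subst (_< p ℚ.* q) (ℚ.*-zeroʳ p) (ℚ.*-monoʳ-<-pos p {{ℚ.positive 0<p}} 0<q)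

  *-mono-≤ : ∀ {p q r s} → 0ℚ ≤ r → 0ℚ ≤ q → p ≤ q → r ≤ s → p ℚ.* r ≤ q ℚ.* s
  *-mono-≤ {p} {q} {r} {s} 0≤r 0≤q p≤q r≤s = ℚ.≤-trans
    (ℚ.*-monoʳ-≤-nonNeg r {{ℚ.nonNegative 0≤r}} p≤q)
    (ℚ.*-monoˡ-≤-nonNeg q {{ℚ.nonNegative 0≤q}} r≤s)

  0<1 : 0ℚ < 1ℚ
  0<1 = ℚ.positive⁻¹ 1ℚ

recip : ℚ → ℚ
recip p with p ℚ.≟ 0ℚ
... | yes _   = 0ℚ
... | no  p≢0 = ℚ.1/_ p {{ℚ.≢-nonZero p≢0}}

private opaque
  recip-inverse : ∀ {p} → ¬ p ≡ 0ℚ → p ℚ.* recip p ≡ 1ℚ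
  recip-inverse {p} p≢0 with p ℚ.≟ 0ℚ
  ... | yes p≡0 = ⊥-elim (p≢0 p≡0)
  ... | no  q   = ℚ.*-inverseʳ p {{ℚ.≢-nonZero q}}

  pos⇒≢0 : ∀ {p} → 0ℚ < p → ¬ p ≡ 0ℚ
  pos⇒≢0 0<p refl = ℚ.<-irrefl refl 0<p

  ∣∣-pos⇒≢0 : ∀ {p} → 0ℚ < ∣ p ∣ → ¬ p ≡ 0ℚ
  ∣∣-pos⇒≢0 0<p refl = ℚ.<-irrefl refl 0<p

  0<recip : ∀ {p} → 0ℚ < p → 0ℚ < recip p
  0<recip {p} 0<p with p ℚ.≟ 0ℚ
  ... | yes p≡0 = ⊥-elim (pos⇒≢0 0<p p≡0)
  ... | no  q   = ℚ.positive⁻¹ _ {{ℚ.1/pos⇒pos p {{ℚ.positive 0<p}}}}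

  ∣recip∣-bound : ∀ {ε p} → 0ℚ < ε → ε ≤ ∣ p ∣ → ∣ recip p ∣ ≤ recip ε
  ∣recip∣-bound {ε} {p} 0<ε ε≤p = begin
    r                       ≡⟨ solve 1 (λ r → r := con 1ℚ :* r) refl r ⟩
    1ℚ ℚ.* r                ≡⟨ cong (ℚ._* r) (sym (recip-inverse (pos⇒≢0 0<ε))) ⟩
    ε ℚ.* recip ε ℚ.* r     ≡⟨ solve 3 (λ e s r → e :* s :* r := s :* (r :* e)) refl ε (recip ε) r ⟩
    recip ε ℚ.* (r ℚ.* ε)   ≤⟨ ℚ.*-monoˡ-≤-nonNeg (recip ε) {{nn}}
                                 (ℚ.*-monoˡ-≤-nonNeg r {{ℚ.∣-∣-nonNeg (recip p)}} ε≤p) ⟩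
    recip ε ℚ.* (r ℚ.* ∣ p ∣) ≡⟨ cong (recip ε ℚ.*_) (sym (ℚ.∣p*q∣≡∣p∣*∣q∣ (recip p) p)) ⟩
    recip ε ℚ.* ∣ recip p ℚ.* p ∣ ≡⟨ cong (λ q → recip ε ℚ.* ∣ q ∣)
                                       (trans (ℚ.*-comm (recip p) p)
                                         (recip-inverse (∣∣-pos⇒≢0 (ℚ.<-≤-trans 0<ε ε≤p)))) ⟩
    recip ε ℚ.* 1ℚ          ≡⟨ ℚ.*-identityʳ (recip ε) ⟩
    recip ε                 ∎
    where
    open ℚ.≤-Reasoning
    r : ℚ
    r = ∣ recip p ∣
    nn : ℚ.NonNegative (recip ε)
    nn = ℚ.nonNegative (ℚ.<⇒≤ (0<recip 0<ε))

private
  -- A record, so that g can be inferred.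
  record Small (g : ℕ → ℕ → ℚ) : Set where
    constructor mkSmall
    field
      small : ∀ {ε} → 0ℚ < ε → Eventually₂ λ m n → ∣ g m n ∣ < ε

  open Small

  cauchyˢ : ∀ x → Small (λ m n → seq x m ℚ.- seq x n)
  cauchyˢ x = mkSmall (cauchy x)

  record Bounded (b : ℕ → ℕ → ℚ) : Set where
    constructor mkBounded
    field
      {B}   : ℚ
      0<B   : 0ℚ < B
      bound : Eventually₂ λ m n → ∣ b m n ∣ ≤ B

private opaque
  small-ev : ∀ {g h} → Eventually₂ (λ m n → g m n ≡ h m n) → Small g → Small h
  small-ev {g} {h} (M , e) (mkSmall s) = mkSmall λ {ε} 0<ε → let N , p = s 0<ε in
    M ℕ.⊔ N , λ {m} {n} M⊔N≤m M⊔N≤n →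
      subst (λ q → ∣ q ∣ < ε) (e (ℕ.m⊔n≤o⇒m≤o M N M⊔N≤m) (ℕ.m⊔n≤o⇒m≤o M N M⊔N≤n))
        (p (ℕ.m⊔n≤o⇒n≤o M N M⊔N≤m) (ℕ.m⊔n≤o⇒n≤o M N M⊔N≤n))

  small-ext : ∀ {g h} → (∀ m n → g m n ≡ h m n) → Small g → Small h
  small-ext {g} {h} e = small-ev {g} {h} (0 , λ {m} {n} _ _ → e m n)

  small-0 : ∀ {g} → (∀ m n → g m n ≡ 0ℚ) → Small g
  small-0 e = mkSmall λ {ε} 0<ε → 0 , λ {m} {n} _ _ → subst (λ p → ∣ p ∣ < ε) (sym (e m n)) 0<ε

  small-+ : ∀ {g h} → Small g → Small h → Small (λ m n → g m n ℚ.+ h m n)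
  small-+ {g} {h} (mkSmall s) (mkSmall t) = mkSmall λ {ε} 0<ε →
    let M , p = s (0<½* 0<ε)
        N , q = t (0<½* 0<ε)
    in M ℕ.⊔ N , λ {m} {n} i j →
      ℚ.≤-<-trans (ℚ.∣p+q∣≤∣p∣+∣q∣ (g m n) (h m n))
        (subst (∣ g m n ∣ ℚ.+ ∣ h m n ∣ <_) (½+½ ε)
          (ℚ.+-mono-< (p (ℕ.m⊔n≤o⇒m≤o M N i) (ℕ.m⊔n≤o⇒m≤o M N j))
                      (q (ℕ.m⊔n≤o⇒n≤o M N i) (ℕ.m⊔n≤o⇒n≤o M N j))))

  small-neg : ∀ {g} → Small g → Small (λ m n → ℚ.- g m n)
  small-neg {g} (mkSmall s) = mkSmall λ {ε} 0<ε → let N , p = s 0<ε in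
    N , λ {m} {n} i j → subst (_< ε) (sym (ℚ.∣-p∣≡∣p∣ (g m n))) (p i j)

  small-* : ∀ {b g} → Bounded b → Small g → Small (λ m n → b m n ℚ.* g m n)
  small-* {b} {g} (mkBounded {B} 0<B (M , bd)) (mkSmall s) = mkSmall λ {ε} 0<ε →
    let N , p = s (0<* (0<recip 0<B) 0<ε)
    in M ℕ.⊔ N , λ {m} {n} i j →
      bound ε m n (bd (ℕ.m⊔n≤o⇒m≤o M N i) (ℕ.m⊔n≤o⇒m≤o M N j))
                  (p (ℕ.m⊔n≤o⇒n≤o M N i) (ℕ.m⊔n≤o⇒n≤o M N j))
    where
    open ℚ.≤-Reasoning
    bound : ∀ ε m n → ∣ b m n ∣ ≤ B → ∣ g m n ∣ < recip B ℚ.* ε → ∣ b m n ℚ.* g m n ∣ < ε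
    bound ε m n p q = begin-strict
      ∣ b m n ℚ.* g m n ∣     ≡⟨ ℚ.∣p*q∣≡∣p∣*∣q∣ (b m n) (g m n) ⟩
      ∣ b m n ∣ ℚ.* ∣ g m n ∣ ≤⟨ ℚ.*-monoʳ-≤-nonNeg ∣ g m n ∣ {{ℚ.∣-∣-nonNeg (g m n)}} p ⟩
      B ℚ.* ∣ g m n ∣         <⟨ ℚ.*-monoʳ-<-pos B {{ℚ.positive 0<B}} q ⟩
      B ℚ.* (recip B ℚ.* ε)   ≡⟨ sym (ℚ.*-assoc B (recip B) ε) ⟩
      B ℚ.* recip B ℚ.* ε     ≡⟨ cong (ℚ._* ε) (recip-inverse (pos⇒≢0 0<B)) ⟩
      1ℚ ℚ.* ε                ≡⟨ ℚ.*-identityˡ ε ⟩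
      ε                       ∎

  bounded-seq : ∀ x → ∃ λ B → 0ℚ < B × Eventually λ n → ∣ seq x n ∣ ≤ B
  bounded-seq x = 1ℚ ℚ.+ ∣ seq x N ∣ , 0<B , N , bd
    where
    open ℚ.≤-Reasoning
    N : ℕ
    N = proj₁ (cauchy x 0<1)
    near : ∀ {m n} → N ℕ.≤ m → N ℕ.≤ n → ∣ seq x m ℚ.- seq x n ∣ < 1ℚ
    near = proj₂ (cauchy x 0<1)
    0<B : 0ℚ < 1ℚ ℚ.+ ∣ seq x N ∣
    0<B = ℚ.+-mono-<-≤ (ℚ.positive⁻¹ 1ℚ) (ℚ.0≤∣p∣ (seq x N))
    bd : ∀ {n} → N ℕ.≤ n → ∣ seq x n ∣ ≤ 1ℚ ℚ.+ ∣ seq x N ∣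
    bd {n} N≤n = begin
      ∣ seq x n ∣                               ≡⟨ cong ∣_∣ (solve 2 (λ p q → p := (p :- q) :+ q) refl (seq x n) (seq x N)) ⟩
      ∣ (seq x n ℚ.- seq x N) ℚ.+ seq x N ∣     ≤⟨ ℚ.∣p+q∣≤∣p∣+∣q∣ (seq x n ℚ.- seq x N) (seq x N) ⟩
      ∣ seq x n ℚ.- seq x N ∣ ℚ.+ ∣ seq x N ∣   ≤⟨ ℚ.+-monoˡ-≤ ∣ seq x N ∣ (ℚ.<⇒≤ (near N≤n ℕ.≤-refl)) ⟩
      1ℚ ℚ.+ ∣ seq x N ∣                        ∎

  boundedˡ : ∀ x → Bounded (λ m _ → seq x m)
  boundedˡ x = let B , 0<B , N , p = bounded-seq x in mkBounded 0<B (N , λ i _ → p i)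

  boundedʳ : ∀ x → Bounded (λ _ n → seq x n)
  boundedʳ x = let B , 0<B , N , p = bounded-seq x in mkBounded 0<B (N , λ _ j → p j)

  toSmall : ∀ {x y} → x ≈ᴿ y → Small (λ m _ → seq x m ℚ.- seq y m)
  toSmall x≈y = mkSmall λ 0<ε → let N , p = close x≈y 0<ε in N , λ i _ → p i

  fromSmall : ∀ {x y} → Small (λ m _ → seq x m ℚ.- seq y m) → x ≈ᴿ y
  fromSmall (mkSmall s) = mk≈ᴿ λ 0<ε → let N , p = s 0<ε in N , λ i → p i i

  pointwise : ∀ {x y} → (∀ n → seq x n ≡ seq y n) → x ≈ᴿ y
  pointwise {x} {y} e = fromSmall (small-0 λ m _ →
    trans (cong (ℚ._- seq y m) (e m)) (ℚ.+-inverseʳ (seq y m)))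

  ∣p∣²≡p² : ∀ p → ∣ p ∣ ℚ.* ∣ p ∣ ≡ p ℚ.* p
  ∣p∣²≡p² p with ℚ.∣p∣≡p∨∣p∣≡-p p
  ... | inj₁ eq = cong₂ ℚ._*_ eq eq
  ... | inj₂ eq = trans (cong₂ ℚ._*_ eq eq) (solve 1 (λ p → :- p :* :- p := p :* p) refl p)

  0≤p² : ∀ p → 0ℚ ≤ p ℚ.* p
  0≤p² p = subst (0ℚ ≤_) (trans (ℚ.∣p*q∣≡∣p∣*∣q∣ p p) (∣p∣²≡p² p)) (ℚ.0≤∣p∣ (p ℚ.* p))

  root : ∀ {ε} → 0ℚ < ε → ∀ a b → ∣ a ℚ.* a ℚ.+ b ℚ.* b ∣ < ε ℚ.* ε → ∣ a ∣ < ε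
  root {ε} 0<ε a b h = ℚ.≰⇒> λ ε≤a → ℚ.<-irrefl refl (begin-strict
    ε ℚ.* ε                         ≤⟨ *-mono-≤ (ℚ.<⇒≤ 0<ε) (ℚ.0≤∣p∣ a) ε≤a ε≤a ⟩
    ∣ a ∣ ℚ.* ∣ a ∣                 ≡⟨ ∣p∣²≡p² a ⟩
    a ℚ.* a                         ≡⟨ sym (ℚ.+-identityʳ (a ℚ.* a)) ⟩
    a ℚ.* a ℚ.+ 0ℚ                  ≤⟨ ℚ.+-monoʳ-≤ (a ℚ.* a) (0≤p² b) ⟩
    a ℚ.* a ℚ.+ b ℚ.* b             ≡⟨ sym (ℚ.0≤p⇒∣p∣≡p (ℚ.+-mono-≤ (0≤p² a) (0≤p² b))) ⟩
    ∣ a ℚ.* a ℚ.+ b ℚ.* b ∣         <⟨ h ⟩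
    ε ℚ.* ε                         ∎)
    where open ℚ.≤-Reasoning

  ∣∣-via : ∀ p q {α β} → ∣ p ℚ.- q ∣ < α → ∣ q ∣ < β → ∣ p ∣ < α ℚ.+ β
  ∣∣-via p q {α} {β} h k = begin-strict
    ∣ p ∣                     ≡⟨ cong ∣_∣ (solve 2 (λ p q → p := (p :- q) :+ q) refl p q) ⟩
    ∣ (p ℚ.- q) ℚ.+ q ∣       ≤⟨ ℚ.∣p+q∣≤∣p∣+∣q∣ (p ℚ.- q) q ⟩
    ∣ p ℚ.- q ∣ ℚ.+ ∣ q ∣     <⟨ ℚ.+-mono-< h k ⟩
    α ℚ.+ β                   ∎
    where open ℚ.≤-Reasoning

  ¬away⇒0 : ∀ x → ¬ AwayFrom0 x → Small (λ m _ → seq x m)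
  ¬away⇒0 x ¬away = mkSmall λ {ε} 0<ε → locate ε (0<½* (0<½* 0<ε)) (cauchy x (0<½* (0<½* 0<ε)))
    where
    open ℚ.≤-Reasoning
    locate : ∀ ε → (let δ = ½ ℚ.* (½ ℚ.* ε)) → 0ℚ < δ →
             Eventually₂ (λ m n → ∣ seq x m ℚ.- seq x n ∣ < δ) →
             Eventually₂ (λ m _ → ∣ seq x m ∣ < ε)
    locate ε 0<δ (N , near) = N , λ {m} N≤m _ → ℚ.<-≤-trans
      (∣∣-via (seq x m) (seq x N) (near N≤m ℕ.≤-refl) small′)
      (subst (δ ℚ.+ ½ ℚ.* ε ≤_) (½+½ ε) (ℚ.+-monoˡ-≤ (½ ℚ.* ε) δ≤½ε))
      where
      δ : ℚ
      δ = ½ ℚ.* (½ ℚ.* ε)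
      δ≤½ε : δ ≤ ½ ℚ.* ε
      δ≤½ε = begin
        δ             ≡⟨ sym (ℚ.+-identityʳ δ) ⟩
        δ ℚ.+ 0ℚ      ≤⟨ ℚ.+-monoʳ-≤ δ (ℚ.<⇒≤ 0<δ) ⟩
        δ ℚ.+ δ       ≡⟨ ½+½ (½ ℚ.* ε) ⟩
        ½ ℚ.* ε       ∎
      away : ½ ℚ.* ε ≤ ∣ seq x N ∣ → AwayFrom0 x
      away h = δ , 0<δ , N , λ {m} N≤m → ℚ.≮⇒≥ λ lt → ℚ.<-irrefl refl
        (ℚ.<-≤-trans (subst (∣ seq x N ∣ <_) (½+½ (½ ℚ.* ε))
                       (∣∣-via (seq x N) (seq x m) (near ℕ.≤-refl N≤m) lt)) h)
      small′ : ∣ seq x N ∣ < ½ ℚ.* ε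
      small′ = ℚ.≰⇒> (¬away ∘ away)

opaque
  const-cauchy : ∀ p → IsCauchy (λ _ → p)
  const-cauchy p = small (small-0 (λ _ _ → ℚ.+-inverseʳ p))

  +-cauchy : ∀ x y → IsCauchy (λ n → seq x n ℚ.+ seq y n)
  +-cauchy x y = small (small-ext
    (λ m n → solve 4 (λ a b c d → (a :- b) :+ (c :- d) := (a :+ c) :- (b :+ d)) refl
               (seq x m) (seq x n) (seq y m) (seq y n))
    (small-+ (cauchyˢ x) (cauchyˢ y)))

  neg-cauchy : ∀ x → IsCauchy (λ n → ℚ.- seq x n)
  neg-cauchy x = small (small-ext
    (λ m n → solve 2 (λ a b → :- (a :- b) := (:- a) :- (:- b)) refl (seq x m) (seq x n))
    (small-neg (cauchyˢ x)))

  *-cauchy : ∀ x y → IsCauchy (λ n → seq x n ℚ.* seq y n)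
  *-cauchy x y = small (small-ext
    (λ m n → solve 4 (λ a b c d → a :* (c :- d) :+ d :* (a :- b) := (a :* c) :- (b :* d)) refl
               (seq x m) (seq x n) (seq y m) (seq y n))
    (small-+ (small-* (boundedˡ x) (cauchyˢ y)) (small-* (boundedʳ y) (cauchyˢ x))))

  recip-cauchy : ∀ x → AwayFrom0 x → IsCauchy (recip ∘ seq x)
  recip-cauchy x (ε , 0<ε , N , away) = small (small-ev
    (N , λ {m} {n} i j → diff (≢0 m (away i)) (≢0 n (away j)))
    (small-* (mkBounded {λ m _ → recip (seq x m)} (0<recip 0<ε) (N , λ i _ → ∣recip∣-bound 0<ε (away i)))
      (small-* (mkBounded {λ _ n → recip (seq x n)} (0<recip 0<ε) (N , λ _ j → ∣recip∣-bound 0<ε (away j)))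
        (small-neg (cauchyˢ x)))))
    where
    ≢0 : ∀ m → ε ≤ ∣ seq x m ∣ → ¬ seq x m ≡ 0ℚ
    ≢0 m p = ∣∣-pos⇒≢0 (ℚ.<-≤-trans 0<ε p)
    diff : ∀ {p q} → ¬ p ≡ 0ℚ → ¬ q ≡ 0ℚ →
           recip p ℚ.* (recip q ℚ.* ℚ.- (p ℚ.- q)) ≡ recip p ℚ.- recip q
    diff {p} {q} p≢0 q≢0 = trans
      (solve 4 (λ p q r s → r :* (s :* :- (p :- q)) := r :* (q :* s) :- s :* (p :* r)) refl
         p q (recip p) (recip q))
      (trans (cong₂ (λ u v → recip p ℚ.* u ℚ.- recip q ℚ.* v) (recip-inverse q≢0) (recip-inverse p≢0))
        (cong₂ ℚ._-_ (ℚ.*-identityʳ (recip p)) (ℚ.*-identityʳ (recip q))))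

infixl 6 _+ᴿ_ _-ᴿ_
infixl 7 _*ᴿ_
infix  8 -ᴿ_

fromℚ : ℚ → ℝ
fromℚ p = mkℝ (λ _ → p) (const-cauchy p)

_+ᴿ_ : ℝ → ℝ → ℝ
x +ᴿ y = mkℝ (λ n → seq x n ℚ.+ seq y n) (+-cauchy x y)

_*ᴿ_ : ℝ → ℝ → ℝ
x *ᴿ y = mkℝ (λ n → seq x n ℚ.* seq y n) (*-cauchy x y)

-ᴿ_ : ℝ → ℝ
-ᴿ x = mkℝ (λ n → ℚ.- seq x n) (neg-cauchy x)

_-ᴿ_ : ℝ → ℝ → ℝ
x -ᴿ y = x +ᴿ (-ᴿ y)

-- Only finitely many terms of the sequence can vanish; there recip is 0.
invᴿ : (x : ℝ) → AwayFrom0 x → ℝ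
invᴿ x x#0 = mkℝ (recip ∘ seq x) (recip-cauchy x x#0)

private opaque
  ≈ᴿ-refl : ∀ {x} → x ≈ᴿ x
  ≈ᴿ-refl = pointwise (λ _ → refl)

  ≈ᴿ-sym : ∀ {x y} → x ≈ᴿ y → y ≈ᴿ x
  ≈ᴿ-sym {x} {y} x≈y = fromSmall (small-ext
    (λ m _ → solve 2 (λ a b → :- (a :- b) := b :- a) refl (seq x m) (seq y m))
    (small-neg (toSmall x≈y)))

  ≈ᴿ-trans : ∀ {x y z} → x ≈ᴿ y → y ≈ᴿ z → x ≈ᴿ z
  ≈ᴿ-trans {x} {y} {z} x≈y y≈z = fromSmall (small-ext
    (λ m _ → solve 3 (λ a b c → (a :- b) :+ (b :- c) := a :- c) refl (seq x m) (seq y m) (seq z m))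
    (small-+ (toSmall x≈y) (toSmall y≈z)))

  +ᴿ-cong : ∀ {x x′ y y′} → x ≈ᴿ x′ → y ≈ᴿ y′ → x +ᴿ y ≈ᴿ x′ +ᴿ y′
  +ᴿ-cong {x} {x′} {y} {y′} p q = fromSmall (small-ext
    (λ m _ → solve 4 (λ a b c d → (a :- b) :+ (c :- d) := (a :+ c) :- (b :+ d)) refl
               (seq x m) (seq x′ m) (seq y m) (seq y′ m))
    (small-+ (toSmall p) (toSmall q)))

  -ᴿ-cong : ∀ {x y} → x ≈ᴿ y → -ᴿ x ≈ᴿ -ᴿ y
  -ᴿ-cong {x} {y} p = fromSmall (small-ext
    (λ m _ → solve 2 (λ a b → :- (a :- b) := (:- a) :- (:- b)) refl (seq x m) (seq y m))
    (small-neg (toSmall p)))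

  *ᴿ-cong : ∀ {x x′ y y′} → x ≈ᴿ x′ → y ≈ᴿ y′ → x *ᴿ y ≈ᴿ x′ *ᴿ y′
  *ᴿ-cong {x} {x′} {y} {y′} p q = fromSmall (small-ext
    (λ m _ → solve 4 (λ a b c d → a :* (c :- d) :+ d :* (a :- b) := (a :* c) :- (b :* d)) refl
               (seq x m) (seq x′ m) (seq y m) (seq y′ m))
    (small-+ (small-* (boundedˡ x) (toSmall q)) (small-* (boundedˡ y′) (toSmall p))))

record ℂ : Set where
  constructor _+i_
  field
    re im : ℝ

open ℂ

infix 4 _≈_ _#_ _,≈_

record _≈_ (z w : ℂ) : Set where
  constructor _,≈_
  field
    re≈ : re z ≈ᴿ re w
    im≈ : im z ≈ᴿ im w

open _≈_

infixl 6 _+_ _-_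
infixl 7 _*_
infix  8 -_

0ℂ : ℂ
0ℂ = fromℚ 0ℚ +i fromℚ 0ℚ

1ℂ : ℂ
1ℂ = fromℚ 1ℚ +i fromℚ 0ℚ

_+_ : ℂ → ℂ → ℂ
z + w = (re z +ᴿ re w) +i (im z +ᴿ im w)

-_ : ℂ → ℂ
- z = (-ᴿ re z) +i (-ᴿ im z)

_-_ : ℂ → ℂ → ℂ
z - w = z + (- w)

_*_ : ℂ → ℂ → ℂ
z * w = (re z *ᴿ re w -ᴿ im z *ᴿ im w) +i (re z *ᴿ im w +ᴿ im z *ᴿ re w)

normSq : ℂ → ℝ
normSq z = re z *ᴿ re z +ᴿ im z *ᴿ im z

-- z ≠ w, as apartness: the distance between z and w is positive.  It is tight
-- (#-tight, #⇒≉ below), hence classically the same as ¬ z ≈ w.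
record _#_ (z w : ℂ) : Set where
  constructor mk#
  field
    apart : AwayFrom0 (normSq (z - w))

open _#_

private opaque
  ℂ-pointwise : ∀ {z w} → (∀ n → seq (re z) n ≡ seq (re w) n) →
                (∀ n → seq (im z) n ≡ seq (im w) n) → z ≈ w
  ℂ-pointwise p q = pointwise p ,≈ pointwise q

  ≈-isEquivalence : IsEquivalence _≈_
  ≈-isEquivalence = record
    { refl  = ≈ᴿ-refl ,≈ ≈ᴿ-refl
    ; sym   = λ (p ,≈ q) → ≈ᴿ-sym p ,≈ ≈ᴿ-sym q
    ; trans = λ (p ,≈ q) (p′ ,≈ q′) → ≈ᴿ-trans p p′ ,≈ ≈ᴿ-trans q q′
    }

  +-cong : ∀ {z z′ w w′} → z ≈ z′ → w ≈ w′ → z + w ≈ z′ + w′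
  +-cong (p ,≈ q) (p′ ,≈ q′) = +ᴿ-cong p p′ ,≈ +ᴿ-cong q q′

  -‿cong : ∀ {z w} → z ≈ w → - z ≈ - w
  -‿cong (p ,≈ q) = -ᴿ-cong p ,≈ -ᴿ-cong q

  *-cong : ∀ {z z′ w w′} → z ≈ z′ → w ≈ w′ → z * w ≈ z′ * w′
  *-cong (p ,≈ q) (p′ ,≈ q′) =
    +ᴿ-cong (*ᴿ-cong p p′) (-ᴿ-cong (*ᴿ-cong q q′)) ,≈
    +ᴿ-cong (*ᴿ-cong p q′) (*ᴿ-cong q p′)

  +-assoc : ∀ z w v → (z + w) + v ≈ z + (w + v)
  +-assoc z w v = ℂ-pointwise (λ n → ℚ.+-assoc (seq (re z) n) (seq (re w) n) (seq (re v) n))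
                              (λ n → ℚ.+-assoc (seq (im z) n) (seq (im w) n) (seq (im v) n))

  +-comm : ∀ z w → z + w ≈ w + z
  +-comm z w = ℂ-pointwise (λ n → ℚ.+-comm (seq (re z) n) (seq (re w) n))
                           (λ n → ℚ.+-comm (seq (im z) n) (seq (im w) n))

  +-identityˡ : ∀ z → 0ℂ + z ≈ z
  +-identityˡ z = ℂ-pointwise (λ n → ℚ.+-identityˡ _) (λ n → ℚ.+-identityˡ _)

  +-identityʳ : ∀ z → z + 0ℂ ≈ z
  +-identityʳ z = ℂ-pointwise (λ n → ℚ.+-identityʳ _) (λ n → ℚ.+-identityʳ _)

  -‿inverseˡ : ∀ z → - z + z ≈ 0ℂ
  -‿inverseˡ z = ℂ-pointwise (λ n → ℚ.+-inverseˡ (seq (re z) n)) (λ n → ℚ.+-inverseˡ (seq (im z) n))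

  -‿inverseʳ : ∀ z → z + - z ≈ 0ℂ
  -‿inverseʳ z = ℂ-pointwise (λ n → ℚ.+-inverseʳ (seq (re z) n)) (λ n → ℚ.+-inverseʳ (seq (im z) n))

  *-assoc : ∀ z w v → (z * w) * v ≈ z * (w * v)
  *-assoc z w v = ℂ-pointwise
    (λ n → solve 6 (λ a b c d e f →
        (a :* c :- b :* d) :* e :- (a :* d :+ b :* c) :* f
          := a :* (c :* e :- d :* f) :- b :* (c :* f :+ d :* e)) refl
        (seq (re z) n) (seq (im z) n) (seq (re w) n) (seq (im w) n) (seq (re v) n) (seq (im v) n))
    (λ n → solve 6 (λ a b c d e f →
        (a :* c :- b :* d) :* f :+ (a :* d :+ b :* c) :* e
          := a :* (c :* f :+ d :* e) :+ b :* (c :* e :- d :* f)) refl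
        (seq (re z) n) (seq (im z) n) (seq (re w) n) (seq (im w) n) (seq (re v) n) (seq (im v) n))

  *-comm : ∀ z w → z * w ≈ w * z
  *-comm z w = ℂ-pointwise
    (λ n → solve 4 (λ a b c d → a :* c :- b :* d := c :* a :- d :* b) refl
        (seq (re z) n) (seq (im z) n) (seq (re w) n) (seq (im w) n))
    (λ n → solve 4 (λ a b c d → a :* d :+ b :* c := c :* b :+ d :* a) refl
        (seq (re z) n) (seq (im z) n) (seq (re w) n) (seq (im w) n))

  *-identityˡ : ∀ z → 1ℂ * z ≈ z
  *-identityˡ z = ℂ-pointwise
    (λ n → solve 2 (λ a b → con 1ℚ :* a :- con 0ℚ :* b := a) refl (seq (re z) n) (seq (im z) n))
    (λ n → solve 2 (λ a b → con 1ℚ :* b :+ con 0ℚ :* a := b) refl (seq (re z) n) (seq (im z) n))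

  *-distribˡ : ∀ z w v → z * (w + v) ≈ z * w + z * v
  *-distribˡ z w v = ℂ-pointwise
    (λ n → solve 6 (λ a b c d e f →
        a :* (c :+ e) :- b :* (d :+ f) := (a :* c :- b :* d) :+ (a :* e :- b :* f)) refl
        (seq (re z) n) (seq (im z) n) (seq (re w) n) (seq (im w) n) (seq (re v) n) (seq (im v) n))
    (λ n → solve 6 (λ a b c d e f →
        a :* (d :+ f) :+ b :* (c :+ e) := (a :* d :+ b :* c) :+ (a :* f :+ b :* e)) refl
        (seq (re z) n) (seq (im z) n) (seq (re w) n) (seq (im w) n) (seq (re v) n) (seq (im v) n))

  isCommutativeRing : IsCommutativeRing _≈_ _+_ _*_ -_ 0ℂ 1ℂ
  isCommutativeRing = record
    { isRing = record
      { +-isAbelianGroup = record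
        { isGroup = record
          { isMonoid = record
            { isSemigroup = record
              { isMagma = record { isEquivalence = ≈-isEquivalence ; ∙-cong = +-cong }
              ; assoc   = +-assoc
              }
            ; identity = +-identityˡ , +-identityʳ
            }
          ; inverse = -‿inverseˡ , -‿inverseʳ
          ; ⁻¹-cong = -‿cong
          }
        ; comm = +-comm
        }
      ; *-cong     = *-cong
      ; *-assoc    = *-assoc
      ; *-identity = *-identityˡ , λ z → ≈.trans (*-comm z 1ℂ) (*-identityˡ z)
      ; distrib    = *-distribˡ , λ z w v → ≈.trans (*-comm (w + v) z)
                       (≈.trans (*-distribˡ z w v) (+-cong (*-comm z w) (*-comm z v)))
      }
    ; *-comm = *-comm
    }
    where module ≈ = IsEquivalence ≈-isEquivalence

ℂ-commutativeRing : CommutativeRing _ _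
ℂ-commutativeRing = record { isCommutativeRing = isCommutativeRing }

open import Algebra.Properties.Semiring.Exp (CommutativeRing.semiring ℂ-commutativeRing) public
  using (_^_)

private opaque
  away-ext : ∀ {x y} → (∀ n → seq x n ≡ seq y n) → AwayFrom0 x → AwayFrom0 y
  away-ext e (ε , 0<ε , N , h) = ε , 0<ε , N , λ {n} N≤n → subst (λ p → ε ≤ ∣ p ∣) (e n) (h N≤n)

  normSq-0 : ∀ z n → seq (normSq (z - 0ℂ)) n ≡ seq (normSq z) n
  normSq-0 z n = cong₂ (λ a b → a ℚ.* a ℚ.+ b ℚ.* b)
    (ℚ.+-identityʳ (seq (re z) n)) (ℚ.+-identityʳ (seq (im z) n))

  normSq-away : ∀ {z} → z # 0ℂ → AwayFrom0 (normSq z)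
  normSq-away {z} z#0 = away-ext {normSq (z - 0ℂ)} {normSq z} (normSq-0 z) (apart z#0)

  away-normSq : ∀ {z} → AwayFrom0 (normSq z) → z # 0ℂ
  away-normSq {z} h = mk# (away-ext {normSq z} {normSq (z - 0ℂ)} (sym ∘ normSq-0 z) h)

  away-* : ∀ {x y} → AwayFrom0 x → AwayFrom0 y → AwayFrom0 (x *ᴿ y)
  away-* {x} {y} (ε , 0<ε , M , p) (δ , 0<δ , N , q) = ε ℚ.* δ , 0<* 0<ε 0<δ , M ℕ.⊔ N , λ {n} i →
    subst (ε ℚ.* δ ≤_) (sym (ℚ.∣p*q∣≡∣p∣*∣q∣ (seq x n) (seq y n)))
      (*-mono-≤ (ℚ.<⇒≤ 0<δ) (ℚ.0≤∣p∣ (seq x n)) (p (ℕ.m⊔n≤o⇒m≤o M N i)) (q (ℕ.m⊔n≤o⇒n≤o M N i)))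

infix 8 _⁻¹[_]
infixl 7 _/_[_]

_⁻¹[_] : (z : ℂ) → z # 0ℂ → ℂ
z ⁻¹[ z#0 ] = (re z *ᴿ r) +i (-ᴿ (im z *ᴿ r))
  where r = invᴿ (normSq z) (normSq-away z#0)

_/_[_] : ℂ → (w : ℂ) → w # 0ℂ → ℂ
z / w [ w#0 ] = z * w ⁻¹[ w#0 ]

opaque
  ⁻¹-inverseʳ : ∀ z (z#0 : z # 0ℂ) → z * z ⁻¹[ z#0 ] ≈ 1ℂ
  ⁻¹-inverseʳ z z#0 = fromSmall (small-ev real (small-0 λ _ _ → refl)) ,≈
    pointwise (λ n → solve 3 (λ a b r → a :* :- (b :* r) :+ b :* (a :* r) := con 0ℚ) refl
      (seq (re z) n) (seq (im z) n) (recip (seq (normSq z) n)))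
    where
    real : Eventually₂ λ m _ → 0ℚ ≡ seq (re (z * z ⁻¹[ z#0 ])) m ℚ.- 1ℚ
    real = let ε , 0<ε , N , h = normSq-away z#0 in N , λ {m} i _ → sym (trans
      (cong (ℚ._- 1ℚ) (trans
        (solve 3 (λ a b r → a :* (a :* r) :- b :* :- (b :* r) := (a :* a :+ b :* b) :* r) refl
          (seq (re z) m) (seq (im z) m) (recip (seq (normSq z) m)))
        (recip-inverse (∣∣-pos⇒≢0 (ℚ.<-≤-trans 0<ε (h i))))))
      (ℚ.+-inverseʳ 1ℚ))

  1#0 : 1ℂ # 0ℂ
  1#0 = away-normSq (1ℚ , 0<1 , 0 , λ _ → ℚ.≤-refl)

  *-#0 : ∀ {z w} → z # 0ℂ → w # 0ℂ → z * w # 0ℂ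
  *-#0 {z} {w} z#0 w#0 = away-normSq (away-ext {normSq z *ᴿ normSq w} {normSq (z * w)}
    (λ n → solve 4 (λ a b c d → (a :* a :+ b :* b) :* (c :* c :+ d :* d)
        := (a :* c :- b :* d) :* (a :* c :- b :* d) :+ (a :* d :+ b :* c) :* (a :* d :+ b :* c)) refl
        (seq (re z) n) (seq (im z) n) (seq (re w) n) (seq (im w) n))
    (away-* {normSq z} {normSq w} (normSq-away z#0) (normSq-away w#0)))

  ^-#0 : ∀ {z} → z # 0ℂ → ∀ n → z ^ n # 0ℂ
  ^-#0 z#0 zero    = 1#0
  ^-#0 z#0 (suc n) = *-#0 z#0 (^-#0 z#0 n)

  #⇒≉ : ∀ {z w} → z # w → ¬ z ≈ w
  #⇒≉ {z} {w} (mk# (ε , 0<ε , M , far)) z≈w = contra (small d≈0 0<ε)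
    where
    d≈0 : Small (λ m _ → seq (normSq (z - w)) m)
    d≈0 = small-+ (small-* (boundedˡ (re (z - w))) (toSmall (re≈ z≈w)))
                  (small-* (boundedˡ (im (z - w))) (toSmall (im≈ z≈w)))
    contra : ¬ Eventually₂ (λ m _ → ∣ seq (normSq (z - w)) m ∣ < ε)
    contra (N , near) = ℚ.<-irrefl refl
      (ℚ.≤-<-trans (far (ℕ.m≤m⊔n M N)) (near (ℕ.m≤n⊔m M N) (ℕ.m≤n⊔m M N)))

  #-tight : ∀ {z w} → ¬ z # w → z ≈ w
  #-tight {z} {w} ¬z#w = fromSmall (roots a b d≈0) ,≈ fromSmall (roots b a (small-ext swap d≈0))
    where
    a b : ℕ → ℚ
    a = seq (re (z - w))
    b = seq (im (z - w))
    swap : ∀ m (_ : ℕ) → a m ℚ.* a m ℚ.+ b m ℚ.* b m ≡ b m ℚ.* b m ℚ.+ a m ℚ.* a m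
    swap m _ = ℚ.+-comm (a m ℚ.* a m) (b m ℚ.* b m)
    roots : ∀ (a b : ℕ → ℚ) → Small (λ m _ → a m ℚ.* a m ℚ.+ b m ℚ.* b m) → Small (λ m _ → a m)
    roots a b (mkSmall s) = mkSmall λ 0<ε → let N , p = s (0<* 0<ε 0<ε) in
      N , λ {m} i j → root 0<ε (a m) (b m) (p i j)
    d≈0 : Small (λ m _ → a m ℚ.* a m ℚ.+ b m ℚ.* b m)
    d≈0 = ¬away⇒0 (normSq (z - w)) (¬z#w ∘ mk#)

∑ : {A : Set} → List A → (A → ℂ) → ℂ
∑ xs f = foldr (λ x s → f x + s) 0ℂ xs

infix 5 ∑
syntax ∑ xs (λ x → e) = ∑[ x ∈ xs ] e

[1‥_] : ℕ → List ℕ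
[1‥ n ] = map suc (upTo n)

divisors : ℕ → List ℕ
divisors n = filter (_∣? n) [1‥ n ]

-- The sequences (k₁, k₂, …) are truncated to (k₁, …, kₙ): in a partition of n
-- no part exceeds n.  The multiplicity of the part j = suc (toℕ i) is lookup π i.
weight : ∀ {n} → Vec ℕ n → ℕ
weight π = sum (map (λ i → suc (toℕ i) ℕ.* lookup π i) (allFin _))

vectors : {A : Set} (n : ℕ) → List A → List (Vec A n)
vectors zero    xs = Vec.[] ∷ []
vectors (suc n) xs = cartesianProductWith Vec._∷_ xs (vectors n xs)

-- See ∈-P⁺, ∈-P⁻ and P-unique: every partition of n is listed exactly once.
P : (n : ℕ) → List (Vec ℕ n)
P n = filter (λ π → weight π ℕ.≟ n) (vectors n (upTo (suc n)))

parts : ∀ {n} → Vec ℕ n → List ℕ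
parts {n} π = map (suc ∘ toℕ) (filter (λ i → 0 ℕ.<? lookup π i) (allFin n))

k : ∀ {n} → Vec ℕ n → ℕ
k π = Vec.sum π

Q : ∀ {n} → Vec ℕ n → ℕ
Q π = length (parts π)

-- The first arguments of min and max only matter for the empty list: all
-- parts lie between 1 and n.
s : ∀ {n} → Vec ℕ n → ℕ
s {n} π = min n (parts π)

l : ∀ {n} → Vec ℕ n → ℕ
l π = max 0 (parts π)

private
  ∈⇒≤sum : ∀ {x xs} → x ∈ xs → x ℕ.≤ sum xs
  ∈⇒≤sum {xs = y ∷ ys} (here refl) = ℕ.m≤m+n y (sum ys)
  ∈⇒≤sum {xs = y ∷ ys} (there x∈)  = ℕ.≤-trans (∈⇒≤sum x∈) (ℕ.m≤n+m (sum ys) y)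

  lookup≤weight : ∀ {n} (π : Vec ℕ n) i → lookup π i ℕ.≤ weight π
  lookup≤weight π i = ℕ.≤-trans (ℕ.m≤n*m (lookup π i) (suc (toℕ i)))
    (∈⇒≤sum (∈-map⁺ (λ i → suc (toℕ i) ℕ.* lookup π i) (∈-allFin i)))

  ∈-vectors : ∀ {A : Set} {xs : List A} {n} (v : Vec A n) →
              (∀ i → lookup v i ∈ xs) → v ∈ vectors n xs
  ∈-vectors Vec.[]       _ = here refl
  ∈-vectors (x Vec.∷ v) h =
    ∈-cartesianProductWith⁺ Vec._∷_ (h Fin.zero) (∈-vectors v (h ∘ Fin.suc))

  vectors-unique : ∀ {A : Set} {xs : List A} n → Unique xs → Unique (vectors n xs)
  vectors-unique zero    u = [] ∷ []
  vectors-unique (suc n) u =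
    Unique.cartesianProductWith⁺ Vec._∷_ Vec.∷-injective u (vectors-unique n u)

∈-P⁺ : ∀ {n} (π : Vec ℕ n) → weight π ≡ n → π ∈ P n
∈-P⁺ {n} π w≡n = ∈-filter⁺ (λ π → weight π ℕ.≟ n)
  (∈-vectors π λ i → ∈-upTo⁺ (ℕ.s≤s (subst (lookup π i ℕ.≤_) w≡n (lookup≤weight π i)))) w≡n

∈-P⁻ : ∀ {n} {π : Vec ℕ n} → π ∈ P n → weight π ≡ n
∈-P⁻ {n} π∈P = proj₂ (∈-filter⁻ (λ π → weight π ℕ.≟ n) {xs = vectors n (upTo (suc n))} π∈P)

P-unique : ∀ n → Unique (P n)
P-unique n = Unique.filter⁺ (λ π → weight π ℕ.≟ n) (vectors-unique n (Unique.upTo⁺ (suc n)))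

{-# OPTIONS --safe #-}
module Submission where

open import Algebra.Bundles using (CommutativeRing)
open import Algebra.Morphism.Structures using (IsRingHomomorphism)
open import Data.Bool.Base using (true; false; if_then_else_)
import Data.Fin.Base as Fin
open import Data.List.Base using (List; []; _∷_; _++_; map; filter; foldr; length;
  tabulate; allFin; upTo; cartesianProductWith)
open import Data.List.Extrema.Nat using (min; max)
open import Data.List.Membership.Propositional using (_∈_)
open import Data.List.Membership.Propositional.Properties using (∈-upTo⁻)
open import Data.List.Properties using (map-upTo; map-tabulate; map-∘; length-map; tabulate-cong)
open import Data.List.Relation.Unary.Any using (here; there)
open import Data.Nat.Base as ℕ using (ℕ; zero; suc; _∸_; _≤_; _≥_; z≤n; s≤s)
import Data.Nat.Properties as ℕ
open import Data.Nat.Divisibility using (_∣_; _∣?_; divides)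
open import Data.Nat.ListAction using (sum)
open import Data.Product.Base using (_,_)
open import Data.Sum.Base using (inj₁; inj₂)
open import Data.Vec.Base as Vec using (Vec)
open import Function.Base using (_∘_; id)
open import Relation.Binary.PropositionalEquality as ≡ using (_≡_; _≢_; refl)
open import Relation.Nullary using (Dec; does; yes; no; ¬_; contradiction)
open import Relation.Unary using (Pred; Decidable)
open import Defs using ([1‥_]; divisors; weight; vectors; P; parts; k; Q; s; l; ∈-P⁻)

-- Write u = t − 1.  A partition with largest part l contributes
-- t^(k_l − 1) · ∏ u t^(k_j − 1), the product being over its parts j < l, and the
-- inner sum contains aᵢ exactly if i ≤ l and all parts exceed l − i.  So the
-- coefficient of aᵢ has the generating function
--   Dᵢ = ∑_{l ≥ i} (∏_{l−i < j < l} Wⱼ) Hₗ,   Hⱼ = qʲ/(1 − tqʲ),   Wⱼ = 1 + uHⱼ = (1 − qʲ)/(1 − tqʲ).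
-- The terms of Dᵢ − tDᵢ₊₁ telescope to Kᵢ = qⁱ/(1 − qⁱ), whose coefficient at qⁿ is 1
-- if i ∣ n and 0 otherwise; iterating Dᵢ = Kᵢ + tDᵢ₊₁ yields the divisor sum.
-- Modulo qⁿ⁺¹ all sums and products are finite.

-- A prescribed smallest part ties the multiplicities together, whereas "all parts exceed l - i" is
-- a condition on each multiplicity separately; this is what makes Dᵢ a sum of products. The
-- recurrence is read off the right side: for a divisor d ≥ i of n the coefficient of aᵢ is t^(d-i),
-- so Dᵢ has to be ∑_{d ≥ i} t^(d-i) K_d, which amounts to Dᵢ = Kᵢ + tDᵢ₊₁ together with Dₙ₊₁ = 0.
-- The obstacle is the denominators. As q is nilpotent, qʲ/(1 - vqʲ) is a finite sum y with y = qʲ(1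
-- + vy) exactly, and the telescoping uses H and K only through this equation. Coefficients lie in
-- an arbitrary commutative ring; division by t is represented by elements `v` and `τ i` with tv = u
-- and tⁱ · `τ i` = 1.

-- Finite sums and Iverson brackets.

module Sums {c ℓ} (R : CommutativeRing c ℓ) where
  open CommutativeRing R hiding (refl; zero)
  open CommutativeRing R using () renaming (refl to ≈-refl)
  open import Algebra.Properties.CommutativeSemigroup +-commutativeSemigroup using (interchange)

  ∑ : {A : Set} → List A → (A → Carrier) → Carrier
  ∑ xs f = foldr (λ x s → f x + s) 0# xs

  ∑-cong-∈ : ∀ {A : Set} (xs : List A) {f g} → (∀ {x} → x ∈ xs → f x ≈ g x) → ∑ xs f ≈ ∑ xs g
  ∑-cong-∈ []       h = ≈-refl
  ∑-cong-∈ (x ∷ xs) h = +-cong (h (here refl)) (∑-cong-∈ xs (h ∘ there))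

  ∑-cong : ∀ {A : Set} (xs : List A) {f g} → (∀ x → f x ≈ g x) → ∑ xs f ≈ ∑ xs g
  ∑-cong xs h = ∑-cong-∈ xs (λ {x} _ → h x)

  ∑-0 : ∀ {A : Set} (xs : List A) {f} → (∀ x → f x ≈ 0#) → ∑ xs f ≈ 0#
  ∑-0 []       h = ≈-refl
  ∑-0 (x ∷ xs) h = trans (+-cong (h x) (∑-0 xs h)) (+-identityˡ 0#)

  ∑-+ : ∀ {A : Set} (xs : List A) f g → ∑ xs (λ x → f x + g x) ≈ ∑ xs f + ∑ xs g
  ∑-+ []       f g = sym (+-identityˡ 0#)
  ∑-+ (x ∷ xs) f g = trans (+-congˡ (∑-+ xs f g)) (interchange _ _ _ _)

  *-∑ : ∀ {A : Set} (xs : List A) y f → y * ∑ xs f ≈ ∑ xs (λ x → y * f x)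
  *-∑ []       y f = zeroʳ y
  *-∑ (x ∷ xs) y f = trans (distribˡ y _ _) (+-congˡ (*-∑ xs y f))

  ∑-* : ∀ {A : Set} (xs : List A) f y → ∑ xs f * y ≈ ∑ xs (λ x → f x * y)
  ∑-* []       f y = zeroˡ y
  ∑-* (x ∷ xs) f y = trans (distribʳ y _ _) (+-congˡ (∑-* xs f y))

  ∑-swap : ∀ {A B : Set} (xs : List A) (ys : List B) (f : A → B → Carrier) →
           ∑ xs (λ x → ∑ ys (f x)) ≈ ∑ ys (λ y → ∑ xs (λ x → f x y))
  ∑-swap []       ys f = sym (∑-0 ys (λ _ → ≈-refl))
  ∑-swap (x ∷ xs) ys f = trans (+-congˡ (∑-swap xs ys f)) (sym (∑-+ ys (f x) _))

  ∑-++ : ∀ {A : Set} (xs ys : List A) f → ∑ (xs ++ ys) f ≈ ∑ xs f + ∑ ys f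
  ∑-++ []       ys f = sym (+-identityˡ _)
  ∑-++ (x ∷ xs) ys f = trans (+-congˡ (∑-++ xs ys f)) (sym (+-assoc _ _ _))

  ∑-map : ∀ {A B : Set} (h : A → B) (xs : List A) f → ∑ (map h xs) f ≈ ∑ xs (f ∘ h)
  ∑-map h []       f = ≈-refl
  ∑-map h (x ∷ xs) f = +-congˡ (∑-map h xs f)

  ∑-upTo-suc : ∀ n f → ∑ (upTo (suc n)) f ≈ f 0 + ∑ (upTo n) (f ∘ suc)
  ∑-upTo-suc n f = +-congˡ (trans (reflexive (≡.cong (λ xs → ∑ xs f) (≡.sym (map-upTo suc n))))
                                  (∑-map suc (upTo n) f))

  ∑-upTo-sucʳ : ∀ n f → ∑ (upTo (suc n)) f ≈ ∑ (upTo n) f + f n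
  ∑-upTo-sucʳ zero    f = trans (+-identityʳ _) (sym (+-identityˡ _))
  ∑-upTo-sucʳ (suc n) f = trans (∑-upTo-suc (suc n) f) (trans (+-congˡ (∑-upTo-sucʳ n (f ∘ suc)))
    (trans (sym (+-assoc _ _ _)) (+-congʳ (sym (∑-upTo-suc n f)))))

  ∑-cartesianProductWith : ∀ {A B C : Set} (h : A → B → C) xs ys f →
    ∑ (cartesianProductWith h xs ys) f ≈ ∑ xs (λ x → ∑ ys (λ y → f (h x y)))
  ∑-cartesianProductWith h []       ys f = ≈-refl
  ∑-cartesianProductWith h (x ∷ xs) ys f =
    trans (∑-++ (map (h x) ys) _ f)
      (+-cong (∑-map (h x) ys f) (∑-cartesianProductWith h xs ys f))

  -- Only the boolean of the decision enters, so `[ suc i ℕ.≟ suc j ]` and `[ i ℕ.≟ j ]` are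
  -- definitionally equal; the inductions on indices rely on this.
  [_] : ∀ {p} {P : Set p} → Dec P → Carrier
  [ P? ] = if does P? then 1# else 0#

  [yes] : ∀ {p} {P : Set p} (P? : Dec P) → P → [ P? ] ≈ 1#
  [yes] (yes _) _ = ≈-refl
  [yes] (no ¬p) p = contradiction p ¬p

  [no] : ∀ {p} {P : Set p} (P? : Dec P) → ¬ P → [ P? ] ≈ 0#
  [no] (yes p) ¬p = contradiction p ¬p
  [no] (no _)  _  = ≈-refl

  ∑-filter : ∀ {A : Set} {p} {P : Pred A p} (P? : Decidable P) xs f →
             ∑ (filter P? xs) f ≈ ∑ xs (λ x → [ P? x ] * f x)
  ∑-filter P? []       f = ≈-refl
  ∑-filter P? (x ∷ xs) f with does (P? x)
  ... | true  = +-cong (sym (*-identityˡ (f x))) (∑-filter P? xs f)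
  ... | false = trans (∑-filter P? xs f) (trans (sym (+-identityˡ _)) (+-congʳ (sym (zeroˡ (f x)))))

  ∑-[≟] : ∀ {n j} → j ℕ.< n → ∑ (upTo n) (λ i → [ i ℕ.≟ j ]) ≈ 1#
  ∑-[≟] {suc n} {zero}  _         =
    trans (∑-upTo-suc n _) (trans (+-congˡ (∑-0 (upTo n) λ _ → ≈-refl)) (+-identityʳ 1#))
  ∑-[≟] {suc n} {suc j} (s≤s j<n) =
    trans (∑-upTo-suc n _) (trans (+-identityˡ _) (∑-[≟] j<n))

  -- The only possible `i` is one less than the quotient of `n` by `suc m`, and it lies below `n`. A
  -- quotient 0, which no `suc i` could match, would force `n` to be 0.
  ∑-multiples : ∀ n m → n ≢ 0 → (m∣n? : Dec (suc m ∣ n)) →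
                ∑ (upTo n) (λ i → [ suc m ℕ.* suc i ℕ.≟ n ]) ≈ [ m∣n? ]
  ∑-multiples n m n≢0 (no m∤n) = ∑-0 (upTo n) λ i → [no] (suc m ℕ.* suc i ℕ.≟ n)
    λ eq → m∤n (divides (suc i) (≡.trans (≡.sym eq) (ℕ.*-comm (suc m) (suc i))))
  ∑-multiples n m n≢0 (yes (divides zero    n≡0))  = contradiction n≡0 n≢0
  ∑-multiples n m n≢0 (yes (divides (suc j) refl)) =
    trans (∑-cong (upTo n) same) (∑-[≟] (ℕ.m≤m*n (suc j) (suc m)))
    where
    same : ∀ i → [ suc m ℕ.* suc i ℕ.≟ n ] ≈ [ i ℕ.≟ j ]
    same i = by-cases (i ℕ.≟ j)
      where
      by-cases : (i≟j : Dec (i ≡ j)) → [ suc m ℕ.* suc i ℕ.≟ n ] ≈ [ i≟j ]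
      by-cases (yes refl) = [yes] (suc m ℕ.* suc i ℕ.≟ n) (ℕ.*-comm (suc m) (suc i))
      by-cases (no i≢j)   = [no] (suc m ℕ.* suc i ℕ.≟ n) λ eq → i≢j (ℕ.suc-injective
        (ℕ.*-cancelˡ-≡ (suc i) (suc j) (suc m) (≡.trans eq (ℕ.*-comm (suc j) (suc m)))))

-- Power series truncated after degree n.

module Series {c ℓ} (R : CommutativeRing c ℓ) where
  open import Algebra.Properties.Ring (CommutativeRing.ring R) using (-0#≈0#)
  open CommutativeRing R hiding (refl; zero)
  open CommutativeRing R using () renaming (refl to ≈-refl)
  open import Algebra.Solver.Ring.NaturalCoefficients.Default commutativeSemiring

  infixl 7 _⊛_
  -- The Cauchy product, by recursion on the degree: only the left factor is shifted, so the laws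
  -- below are inductions with the left factor generalised.
  _⊛_ : (ℕ → Carrier) → (ℕ → Carrier) → ℕ → Carrier
  (f ⊛ g) zero    = f 0 * g 0
  (f ⊛ g) (suc m) = f 0 * g (suc m) + ((f ∘ suc) ⊛ g) m

  ε : ℕ → Carrier
  ε zero    = 1#
  ε (suc _) = 0#

  ⊛-cong : ∀ {f f′ g g′} m → (∀ {i} → i ≤ m → f i ≈ f′ i) → (∀ {i} → i ≤ m → g i ≈ g′ i) →
           (f ⊛ g) m ≈ (f′ ⊛ g′) m
  ⊛-cong zero    p q = *-cong (p z≤n) (q z≤n)
  ⊛-cong (suc m) p q = +-cong (*-cong (p z≤n) (q ℕ.≤-refl))
    (⊛-cong m (p ∘ s≤s) (q ∘ ℕ.m≤n⇒m≤1+n))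

  ⊛-zeroˡ : ∀ f m → ((λ _ → 0#) ⊛ f) m ≈ 0#
  ⊛-zeroˡ f zero    = zeroˡ _
  ⊛-zeroˡ f (suc m) = trans (+-cong (zeroˡ _) (⊛-zeroˡ f m)) (+-identityˡ 0#)

  ⊛-identityˡ : ∀ f m → (ε ⊛ f) m ≈ f m
  ⊛-identityˡ f zero    = *-identityˡ _
  ⊛-identityˡ f (suc m) = trans (+-cong (*-identityˡ _) (⊛-zeroˡ f m)) (+-identityʳ _)

  ⊛-distribʳ : ∀ f g h m → ((λ i → g i + h i) ⊛ f) m ≈ (g ⊛ f) m + (h ⊛ f) m
  ⊛-distribʳ f g h zero    = distribʳ _ _ _
  ⊛-distribʳ f g h (suc m) = trans (+-congˡ (⊛-distribʳ f (g ∘ suc) (h ∘ suc) m))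
    (solve 5 (λ a b d x y → (a :+ b) :* d :+ (x :+ y) := (a :* d :+ x) :+ (b :* d :+ y)) ≈-refl
      (g 0) (h 0) (f (suc m)) (((g ∘ suc) ⊛ f) m) (((h ∘ suc) ⊛ f) m))

  ⊛-scaleˡ : ∀ a f g m → ((λ i → a * f i) ⊛ g) m ≈ a * (f ⊛ g) m
  ⊛-scaleˡ a f g zero    = *-assoc _ _ _
  ⊛-scaleˡ a f g (suc m) = trans (+-cong (*-assoc _ _ _) (⊛-scaleˡ a (f ∘ suc) g m))
    (sym (distribˡ _ _ _))

  ⊛-assoc : ∀ f g h m → ((f ⊛ g) ⊛ h) m ≈ (f ⊛ (g ⊛ h)) m
  ⊛-assoc f g h zero    = *-assoc _ _ _
  ⊛-assoc f g h (suc m) = trans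
    (+-congˡ (trans (⊛-distribʳ h _ _ m)
      (+-cong (⊛-scaleˡ (f 0) (g ∘ suc) h m) (⊛-assoc (f ∘ suc) g h m))))
    (solve 5 (λ a b d x y → (a :* b) :* d :+ (a :* x :+ y) := a :* (b :* d :+ x) :+ y) ≈-refl
      (f 0) (g 0) (h (suc m)) (((g ∘ suc) ⊛ h) m) (((f ∘ suc) ⊛ (g ⊛ h)) m))

  -- The mirror image of the defining clause, shifting the right factor; commutativity then follows
  -- by matching the two recursions.
  ⊛-sucʳ : ∀ f g m → (f ⊛ g) (suc m) ≈ f (suc m) * g 0 + (f ⊛ (g ∘ suc)) m
  ⊛-sucʳ f g zero    = +-comm _ _
  ⊛-sucʳ f g (suc m) = trans (+-congˡ (⊛-sucʳ (f ∘ suc) g m))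
    (solve 3 (λ x y z → x :+ (y :+ z) := y :+ (x :+ z)) ≈-refl _ _ _)

  ⊛-comm : ∀ f g m → (f ⊛ g) m ≈ (g ⊛ f) m
  ⊛-comm f g zero    = *-comm _ _
  ⊛-comm f g (suc m) = trans (+-cong (*-comm _ _) (⊛-comm (f ∘ suc) g m)) (sym (⊛-sucʳ g f m))

  -- R[q]/(qⁿ⁺¹): sequences of coefficients, of which only those up to n count.
  truncated : ℕ → CommutativeRing c ℓ
  truncated n = record
    { Carrier = ℕ → Carrier
    ; _≈_ = λ f g → ∀ m → m ≤ n → f m ≈ g m
    ; _+_ = λ f g m → f m + g m
    ; _*_ = _⊛_
    ; -_  = λ f m → - f m
    ; 0#  = λ _ → 0#
    ; 1#  = ε
    ; isCommutativeRing = record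
      { isRing = record
        { +-isAbelianGroup = record
          { isGroup = record
            { isMonoid = record
              { isSemigroup = record
                { isMagma = record
                  { isEquivalence = record
                    { refl  = λ _ _ → ≈-refl
                    ; sym   = λ p m m≤n → sym (p m m≤n)
                    ; trans = λ p q m m≤n → trans (p m m≤n) (q m m≤n)
                    }
                  ; ∙-cong = λ p q m m≤n → +-cong (p m m≤n) (q m m≤n)
                  }
                ; assoc = λ f g h _ _ → +-assoc _ _ _
                }
              ; identity = (λ f _ _ → +-identityˡ _) , (λ f _ _ → +-identityʳ _)
              }
            ; inverse = (λ f _ _ → -‿inverseˡ _) , (λ f _ _ → -‿inverseʳ _)
            ; ⁻¹-cong = λ p m m≤n → -‿cong (p m m≤n)
            }
          ; comm = λ f g _ _ → +-comm _ _
          }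
        -- A coefficient of degree `m` involves only degrees up to `m`, so agreement up to `n` is
        -- preserved.
        ; *-cong     = λ p q m m≤n → ⊛-cong m (λ i≤m → p _ (ℕ.≤-trans i≤m m≤n)) (λ i≤m → q _ (ℕ.≤-trans i≤m m≤n))
        ; *-assoc    = λ f g h m _ → ⊛-assoc f g h m
        ; *-identity = (λ f m _ → ⊛-identityˡ f m) , (λ f m _ → trans (⊛-comm f ε m) (⊛-identityˡ f m))
        ; distrib    = (λ f g h m _ → trans (⊛-comm f _ m)
                         (trans (⊛-distribʳ f g h m) (+-cong (⊛-comm g f m) (⊛-comm h f m))))
                     , (λ f g h m _ → ⊛-distribʳ f g h m)
        }
      ; *-comm = λ f g m _ → ⊛-comm f g m
      }
    }

  constant : Carrier → ℕ → Carrier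
  constant a zero    = a
  constant a (suc _) = 0#

  constant-⊛ : ∀ a f m → (constant a ⊛ f) m ≈ a * f m
  constant-⊛ a f zero    = ≈-refl
  constant-⊛ a f (suc m) = trans (+-congˡ (⊛-zeroˡ f m)) (+-identityʳ _)

  constant-isRingHomomorphism : ∀ n →
    IsRingHomomorphism rawRing (CommutativeRing.rawRing (truncated n)) constant
  constant-isRingHomomorphism n = record
    { isSemiringHomomorphism = record
      { isNearSemiringHomomorphism = record
        { +-isMonoidHomomorphism = record
          { isMagmaHomomorphism = record
            { isRelHomomorphism = record
              { cong = λ { a≈b zero _ → a≈b ; _ (suc _) _ → ≈-refl } }
            ; homo = λ { a b zero _ → ≈-refl ; a b (suc _) _ → sym (+-identityˡ 0#) }
            }
          ; ε-homo = λ { zero _ → ≈-refl ; (suc _) _ → ≈-refl }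
          }
        ; *-homo = λ { a b zero _ → ≈-refl
                     ; a b (suc m) _ → sym (trans (constant-⊛ a (constant b) (suc m)) (zeroʳ a)) }
        }
      ; 1#-homo = λ { zero _ → ≈-refl ; (suc _) _ → ≈-refl }
      }
    ; -‿homo = λ { a zero _ → ≈-refl ; a (suc _) _ → sym -0#≈0# }
    }

  X : ℕ → Carrier
  X zero    = 0#
  X (suc m) = ε m

  X-⊛-suc : ∀ f m → (X ⊛ f) (suc m) ≈ f m
  X-⊛-suc f m = trans (+-cong (zeroˡ _) (⊛-identityˡ f m)) (+-identityˡ _)

-- Geometric sums in a nilpotent q and the telescoping recurrence.

module WindowSums {c ℓ} (S : CommutativeRing c ℓ) where
  open CommutativeRing S hiding (refl; zero)
  open CommutativeRing S using () renaming (refl to ≈-refl)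
  open import Algebra.Properties.Semiring.Exp semiring using (_^_; ^-homo-*; ^-assocʳ)
  open import Algebra.Properties.Group +-group using () renaming (∙-cancelʳ to +-cancelʳ)
  open import Algebra.Solver.Ring.NaturalCoefficients.Default commutativeSemiring
  open import Relation.Binary.Reasoning.Setoid setoid
  open Sums S

  -- The first `n` terms of y/(1 - ty).
  geometric : ℕ → Carrier → Carrier → Carrier
  geometric n t y = ∑ (upTo n) λ i → t ^ i * y ^ suc i

  geometric-truncated : ∀ n t y → geometric n t y + t ^ n * y ^ suc n ≈ y * (1# + t * geometric n t y)
  geometric-truncated zero    t y = solve 2 (λ t y → con 0 :+ con 1 :* (y :* con 1)
    := y :* (con 1 :+ t :* con 0)) ≈-refl t y
  geometric-truncated (suc n) t y = begin
    geometric (suc n) t y + t ^ suc n * y ^ suc (suc n)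
      ≈⟨ +-congʳ (trans (∑-upTo-sucʳ n _) (geometric-truncated n t y)) ⟩
    y * (1# + t * geometric n t y) + t ^ suc n * y ^ suc (suc n)
      ≈⟨ solve 5 (λ t y g a b → y :* (con 1 :+ t :* g) :+ (t :* a) :* (y :* b)
           := y :* (con 1 :+ t :* (g :+ a :* b))) ≈-refl t y _ _ _ ⟩
    y * (1# + t * (geometric n t y + t ^ n * y ^ suc n))
      ≈⟨ *-congˡ (+-congˡ (*-congˡ (sym (∑-upTo-sucʳ n _)))) ⟩
    y * (1# + t * geometric (suc n) t y) ∎

  module Windows (n : ℕ) (t u q : Carrier) (t≈1+u : t ≈ 1# + u) (qᴺ≈0 : q ^ suc n ≈ 0#) where
    N : ℕ
    N = suc n

    q-nilpotent : ∀ {j} → N ≤ j → q ^ j ≈ 0#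
    q-nilpotent {j} N≤j = begin
      q ^ j                     ≈⟨ reflexive (≡.cong (q ^_) (≡.sym (ℕ.m+[n∸m]≡n N≤j))) ⟩
      q ^ (N ℕ.+ (j ℕ.∸ N))     ≈⟨ ^-homo-* q N _ ⟩
      q ^ N * q ^ (j ℕ.∸ N)     ≈⟨ *-congʳ qᴺ≈0 ⟩
      0# * q ^ (j ℕ.∸ N)        ≈⟨ zeroˡ _ ⟩
      0#                        ∎

    -- The error term of `geometric-truncated` contains `q` to the power `suc j ℕ.* N`, which is at
    -- least `N`. The ratio `v` is free because H needs `t` and K needs 1.
    geometric-q : ∀ v j → geometric n v (q ^ suc j) ≈ q ^ suc j * (1# + v * geometric n v (q ^ suc j))
    geometric-q v j = begin
      geometric n v (q ^ suc j)
        ≈⟨ sym (+-identityʳ _) ⟩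
      geometric n v (q ^ suc j) + 0#
        ≈⟨ +-congˡ (sym (trans (*-congˡ (trans (^-assocʳ q (suc j) N) (q-nilpotent (ℕ.m≤m+n N _)))) (zeroʳ _))) ⟩
      geometric n v (q ^ suc j) + v ^ n * (q ^ suc j) ^ N
        ≈⟨ geometric-truncated n v (q ^ suc j) ⟩
      q ^ suc j * (1# + v * geometric n v (q ^ suc j)) ∎

    -- G j = 1/(1 − tqʲ); D m belongs to the coefficient of a_{m+1}.
    H W G : ℕ → Carrier
    H j = geometric n t (q ^ j)
    W j = 1# + u * H j
    G j = 1# + t * H j

    window : ℕ → ℕ → Carrier
    window o zero    = 1#
    window o (suc m) = W o * window (suc o) m

    -- The index `r` is l - i, the number of smallest sizes that must not occur; the largest part is
    -- `suc r ℕ.+ m`.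
    D : ℕ → Carrier
    D m = ∑ (upTo N) λ r → window (suc r) m * H (suc r ℕ.+ m)

    window-sucʳ : ∀ o m → window o (suc m) ≈ window o m * W (o ℕ.+ m)
    window-sucʳ o zero    rewrite ℕ.+-identityʳ o = *-comm _ _
    window-sucʳ o (suc m) rewrite ℕ.+-suc o m = trans (*-congˡ (window-sucʳ (suc o) m)) (sym (*-assoc _ _ _))

    H-vanishes : ∀ {j} → N ≤ j → H j ≈ 0#
    H-vanishes {suc j} N≤j = trans (geometric-q t j) (trans (*-congʳ (q-nilpotent N≤j)) (zeroˡ _))

    W-trivial : ∀ {j} → N ≤ j → W j ≈ 1#
    W-trivial N≤j = trans (+-congˡ (trans (*-congˡ (H-vanishes N≤j)) (zeroʳ u))) (+-identityʳ 1#)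

    window-trivial : ∀ {o} → N ≤ o → ∀ m → window o m ≈ 1#
    window-trivial N≤o zero    = ≈-refl
    window-trivial N≤o (suc m) = trans (*-cong (W-trivial N≤o) (window-trivial (ℕ.m≤n⇒m≤1+n N≤o) m)) (*-identityˡ 1#)

    -- Every largest part `suc r ℕ.+ n` exceeds `n`. This is where the recurrence stops.
    D-vanishes : D n ≈ 0#
    D-vanishes = ∑-0 (upTo N) λ r → trans (*-congˡ (H-vanishes (s≤s (ℕ.m≤n+m n r)))) (zeroʳ _)

    B : ℕ → ℕ → Carrier
    B m r = window (suc r) m * G (suc r ℕ.+ m)

    -- The relation (1 - tqʲ)Wⱼ = 1 - qʲ at j = r + 1, multiplied by `B m (suc r)`: the longer
    -- window is `W (suc r)` times the window in `B m (suc r)`.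
    B-suc : ∀ m r → window (suc r) (suc m) * G (suc r ℕ.+ suc m) + q ^ suc r * B m (suc r)
                  ≈ B m (suc r) + t * (q ^ suc r * (window (suc r) (suc m) * G (suc r ℕ.+ suc m)))
    B-suc m r rewrite ℕ.+-suc r m = begin
      (1# + u * h) * p * g + z * (p * g)
        ≈⟨ solve 5 (λ u h p g z → (con 1 :+ u :* h) :* p :* g :+ z :* (p :* g)
             := (con 1 :+ z :+ u :* h) :* (p :* g)) ≈-refl u h p g z ⟩
      (1# + z + u * h) * (p * g)
        -- Replacing this one occurrence of `h` by z(1 + th) leaves a polynomial identity.
        ≈⟨ *-congʳ (+-congˡ (*-congˡ (trans (geometric-q t r) (*-congˡ (+-congˡ (*-congʳ t≈1+u)))))) ⟩
      (1# + z + u * (z * (1# + (1# + u) * h))) * (p * g)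
        ≈⟨ solve 5 (λ u h p g z → (con 1 :+ z :+ u :* (z :* (con 1 :+ (con 1 :+ u) :* h))) :* (p :* g)
             := p :* g :+ (con 1 :+ u) :* (z :* ((con 1 :+ u :* h) :* p :* g))) ≈-refl u h p g z ⟩
      p * g + (1# + u) * (z * ((1# + u * h) * p * g))
        ≈⟨ +-congˡ (*-congʳ (sym t≈1+u)) ⟩
      p * g + t * (z * ((1# + u * h) * p * g)) ∎
      where
      h p g z : Carrier
      h = H (suc r)
      p = window (suc (suc r)) m
      g = G (suc (suc r) ℕ.+ m)
      z = q ^ suc r

    module _ (m : ℕ) (K : Carrier) (K-eq : K ≈ q ^ suc m * (1# + K)) where
      -- With F r = (1 − qʳ) B m r and K = qᵐ⁺¹/(1 − qᵐ⁺¹), the r-th term of D m − t D (m+1) is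
      -- K (F (r+1) − F r).  Everything is stated with no subtraction, for the semiring solver.
      K-H : ∀ r → K * (q ^ r * G (suc r ℕ.+ m)) ≈ (1# + K) * H (suc r ℕ.+ m)
      K-H r = begin
        K * (q ^ r * G (suc r ℕ.+ m))
          ≈⟨ *-congʳ K-eq ⟩
        q ^ suc m * (1# + K) * (q ^ r * G (suc r ℕ.+ m))
          ≈⟨ solve 4 (λ a k b g → a :* k :* (b :* g) := k :* (b :* a :* g)) ≈-refl _ _ _ _ ⟩
        (1# + K) * (q ^ r * q ^ suc m * G (suc r ℕ.+ m))
          ≈⟨ *-congˡ (*-congʳ (trans (sym (^-homo-* q r (suc m))) (reflexive (≡.cong (q ^_) (ℕ.+-suc r m))))) ⟩
        (1# + K) * (q ^ (suc r ℕ.+ m) * G (suc r ℕ.+ m))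
          ≈⟨ *-congˡ (sym (geometric-q t (r ℕ.+ m))) ⟩
        (1# + K) * H (suc r ℕ.+ m) ∎

      -- `main` is the same identity with (1 - tz)X in place of (1 - z)B⁺. By `B-suc` these agree;
      -- adding K times `B-suc` to `main` and cancelling KX and KtzX gives the claim.
      telescope-step : ∀ r →
        window (suc r) m * H (suc r ℕ.+ m) + K * (q ^ suc r * B m (suc r)) + K * B m r
        ≈ t * (window (suc r) (suc m) * H (suc r ℕ.+ suc m)) + K * B m (suc r) + K * (q ^ r * B m r)
      telescope-step r = +-cancelʳ (K * X + K * (t * (z * X))) _ _ (begin
        v * h + K * (z * B⁺) + K * B m r + (K * X + K * (t * (z * X)))
          ≈⟨ solve 7 (λ a k z b c x y → a :+ k :* (z :* b) :+ c :+ (k :* x :+ y)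
               := a :+ c :+ y :+ k :* (x :+ z :* b)) ≈-refl _ _ _ _ _ _ _ ⟩
        v * h + K * B m r + K * (t * (z * X)) + K * (X + z * B⁺)
          ≈⟨ +-cong main (*-congˡ (B-suc m r)) ⟩
        t * (v⁺ * h′) + K * X + K * (q ^ r * B m r) + K * (B⁺ + t * (z * X))
          ≈⟨ solve 6 (λ a k x c b y → a :+ k :* x :+ c :+ k :* (b :+ y)
               := a :+ k :* b :+ c :+ (k :* x :+ k :* y)) ≈-refl _ _ _ _ _ _ ⟩
        t * (v⁺ * h′) + K * B⁺ + K * (q ^ r * B m r) + (K * X + K * (t * (z * X))) ∎)
        where
        v v⁺ w h h′ z X B⁺ : Carrier
        v  = window (suc r) m
        v⁺ = window (suc r) (suc m)
        w  = W (suc r ℕ.+ m)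
        h  = H (suc r ℕ.+ m)
        h′ = H (suc r ℕ.+ suc m)
        z  = q ^ suc r
        X  = v⁺ * G (suc r ℕ.+ suc m)
        B⁺ = B m (suc r)
        main : v * h + K * B m r + K * (t * (z * X)) ≈ t * (v⁺ * h′) + K * X + K * (q ^ r * B m r)
        main = begin
          v * h + K * B m r + K * (t * (z * X))
            ≈⟨ +-congˡ (begin
                 K * (t * (z * X)) ≈⟨ solve 5 (λ k t z v g → k :* (t :* (z :* (v :* g)))
                                        := t :* v :* (k :* (z :* g))) ≈-refl _ _ _ _ _ ⟩
                 t * v⁺ * (K * (z * G (suc r ℕ.+ suc m)))
                   ≈⟨ *-congˡ (trans (reflexive (≡.cong (λ j → K * (z * G (suc j))) (ℕ.+-suc r m))) (K-H (suc r))) ⟩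
                 t * v⁺ * ((1# + K) * H (suc (suc r) ℕ.+ m))
                   ≈⟨ *-congˡ (*-congˡ (reflexive (≡.cong (H ∘ suc) (≡.sym (ℕ.+-suc r m))))) ⟩
                 t * v⁺ * ((1# + K) * h′)
                   ≈⟨ *-congʳ (*-cong t≈1+u (window-sucʳ (suc r) m)) ⟩
                 (1# + u) * (v * w) * ((1# + K) * h′) ∎) ⟩
          v * h + K * (v * G (suc r ℕ.+ m)) + (1# + u) * (v * w) * ((1# + K) * h′)
            ≈⟨ +-congʳ (+-congˡ (*-congˡ (*-congˡ (+-congˡ (*-congʳ t≈1+u))))) ⟩
          v * h + K * (v * (1# + (1# + u) * h)) + (1# + u) * (v * w) * ((1# + K) * h′)
            -- The identity comes down to 1 + th = w + h.
            ≈⟨ solve 5 (λ v h k u h′ → let w = con 1 :+ u :* h ; t = con 1 :+ u in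
                 v :* h :+ k :* (v :* (con 1 :+ t :* h)) :+ t :* (v :* w) :* ((con 1 :+ k) :* h′)
                 := t :* ((v :* w) :* h′) :+ k :* ((v :* w) :* (con 1 :+ t :* h′)) :+ v :* ((con 1 :+ k) :* h))
                 ≈-refl v h K u h′ ⟩
          (1# + u) * ((v * w) * h′) + K * ((v * w) * (1# + (1# + u) * h′)) + v * ((1# + K) * h)
            ≈⟨ +-cong (+-cong (*-cong (sym t≈1+u) (*-congʳ (sym (window-sucʳ (suc r) m))))
                 (*-congˡ (*-cong (sym (window-sucʳ (suc r) m)) (+-congˡ (*-congʳ (sym t≈1+u))))))
                 (*-congˡ (sym (K-H r))) ⟩
          t * (v⁺ * h′) + K * X + v * (K * (q ^ r * G (suc r ℕ.+ m)))
            ≈⟨ +-congˡ (solve 4 (λ v k x g → v :* (k :* (x :* g)) := k :* (x :* (v :* g))) ≈-refl _ _ _ _) ⟩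
          t * (v⁺ * h′) + K * X + K * (q ^ r * B m r) ∎

      -- There is no boundary term at 0, because the factor 1 - qʳ of F vanishes there.
      telescope : ∀ r →
        ∑ (upTo r) (λ i → window (suc i) m * H (suc i ℕ.+ m)) + K * (q ^ r * B m r)
        ≈ t * ∑ (upTo r) (λ i → window (suc i) (suc m) * H (suc i ℕ.+ suc m)) + K * B m r
      telescope zero    = solve 3 (λ k b t → con 0 :+ k :* (con 1 :* b) := t :* con 0 :+ k :* b) ≈-refl _ _ _
      telescope (suc r) = +-cancelʳ (K * B m r + K * (q ^ r * B m r)) _ _ (begin
        ∑ (upTo (suc r)) T + K * (q ^ suc r * B m (suc r)) + (K * B m r + K * (q ^ r * B m r))
          ≈⟨ +-congʳ (+-congʳ (∑-upTo-sucʳ r T)) ⟩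
        ∑ (upTo r) T + T r + K * (q ^ suc r * B m (suc r)) + (K * B m r + K * (q ^ r * B m r))
          ≈⟨ solve 5 (λ s a b c d → s :+ a :+ b :+ (c :+ d) := (s :+ d) :+ (a :+ b :+ c)) ≈-refl _ _ _ _ _ ⟩
        (∑ (upTo r) T + K * (q ^ r * B m r)) + (T r + K * (q ^ suc r * B m (suc r)) + K * B m r)
          ≈⟨ +-cong (telescope r) (telescope-step r) ⟩
        (t * ∑ (upTo r) T⁺ + K * B m r) + (t * T⁺ r + K * B m (suc r) + K * (q ^ r * B m r))
          ≈⟨ solve 6 (λ t s a b c d → (t :* s :+ c) :+ (t :* a :+ b :+ d)
               := t :* (s :+ a) :+ b :+ (c :+ d)) ≈-refl _ _ _ _ _ _ ⟩
        t * (∑ (upTo r) T⁺ + T⁺ r) + K * B m (suc r) + (K * B m r + K * (q ^ r * B m r))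
          ≈⟨ +-congʳ (+-congʳ (*-congˡ (sym (∑-upTo-sucʳ r T⁺)))) ⟩
        t * ∑ (upTo (suc r)) T⁺ + K * B m (suc r) + (K * B m r + K * (q ^ r * B m r)) ∎)
        where
        T T⁺ : ℕ → Carrier
        T  i = window (suc i) m * H (suc i ℕ.+ m)
        T⁺ i = window (suc i) (suc m) * H (suc i ℕ.+ suc m)

      -- At the upper end r = N one has qᴺ = 0 and `B m N` = 1, so F N = 1 and exactly K remains.
      D-rec : D m ≈ K + t * D (suc m)
      D-rec = begin
        D m                           ≈⟨ sym (+-identityʳ _) ⟩
        D m + 0#                      ≈⟨ +-congˡ (sym (trans (*-congˡ (trans (*-congʳ qᴺ≈0) (zeroˡ _))) (zeroʳ K))) ⟩
        D m + K * (q ^ N * B m N)     ≈⟨ telescope N ⟩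
        t * D (suc m) + K * B m N     ≈⟨ +-congˡ (*-congˡ B≈1) ⟩
        t * D (suc m) + K * 1#        ≈⟨ solve 2 (λ a k → a :+ k :* con 1 := k :+ a) ≈-refl _ _ ⟩
        K + t * D (suc m)             ∎
        where
        B≈1 : B m N ≈ 1#
        B≈1 = trans (*-cong (window-trivial (ℕ.n≤1+n N) m)
                      (trans (+-congˡ (trans (*-congˡ (H-vanishes (ℕ.≤-trans (ℕ.n≤1+n N) (ℕ.m≤m+n (suc N) m)))) (zeroʳ t))) (+-identityʳ 1#)))
                    (*-identityˡ 1#)

-- Weights of multiplicity vectors and their generating functions.

module VectorWeights {c ℓ} (R : CommutativeRing c ℓ) (t u : CommutativeRing.Carrier R) where
  open CommutativeRing R hiding (refl; zero)
  open import Algebra.Properties.Semiring.Exp semiring using (_^_)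

  -- Factors for a size of multiplicity `x`: a size that must not occur, the largest part (which
  -- must occur), and an optional part below it. Their series are 1, Hⱼ and Wⱼ.
  δ χ ψ : ℕ → Carrier
  δ zero    = 1#
  δ (suc x) = 0#
  χ zero    = 0#
  χ (suc x) = t ^ x
  ψ zero    = 1#
  ψ (suc x) = u * t ^ x

  empty : ∀ {n} → Vec ℕ n → Carrier
  empty Vec.[]      = 1#
  empty (x Vec.∷ π) = δ x * empty π

  -- Nonzero only if the largest part is r + m + 1 and all parts exceed r.
  w : ∀ {n} → ℕ → ℕ → Vec ℕ n → Carrier
  w r       m       Vec.[]      = 0#
  w (suc r) m       (x Vec.∷ π) = δ x * w r m π
  w zero    (suc m) (x Vec.∷ π) = ψ x * w zero m π
  w zero    zero    (x Vec.∷ π) = χ x * empty π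

weightFrom : ∀ {n} → ℕ → Vec ℕ n → ℕ
weightFrom o Vec.[]      = 0
weightFrom o (x Vec.∷ π) = suc o ℕ.* x ℕ.+ weightFrom (suc o) π

module GeneratingFunction
  {c ℓ c′ ℓ′} (R : CommutativeRing c ℓ) (S : CommutativeRing c′ ℓ′)
  (⟦_⟧ : CommutativeRing.Carrier R → CommutativeRing.Carrier S)
  (isHom : IsRingHomomorphism (CommutativeRing.rawRing R) (CommutativeRing.rawRing S) ⟦_⟧)
  (n : ℕ) (t u : CommutativeRing.Carrier R) (q : CommutativeRing.Carrier S) where
  open CommutativeRing S hiding (refl; zero)
  open CommutativeRing S using () renaming (refl to ≈-refl)
  open IsRingHomomorphism isHom using (*-homo; 0#-homo; 1#-homo; ⟦⟧-cong)
  private module R = CommutativeRing R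
  open import Algebra.Properties.Semiring.Exp R.semiring using () renaming (_^_ to _^ᴿ_)
  open import Algebra.Properties.Semiring.Exp semiring using (_^_; ^-homo-*; ^-assocʳ)
  open import Algebra.Properties.CommutativeSemigroup *-commutativeSemigroup using (interchange)
  open import Relation.Binary.Reasoning.Setoid setoid
  open Sums S
  open VectorWeights R t u
  open WindowSums S using (geometric)

  ^-homo : ∀ x i → ⟦ x ^ᴿ i ⟧ ≈ ⟦ x ⟧ ^ i
  ^-homo x zero    = 1#-homo
  ^-homo x (suc i) = trans (*-homo _ _) (*-congˡ (^-homo x i))

  multiplicities : List ℕ
  multiplicities = upTo (suc n)

  partSeries : (ℕ → R.Carrier) → ℕ → Carrier
  partSeries f j = ∑ multiplicities λ x → ⟦ f x ⟧ * q ^ (j ℕ.* x)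

  partSeries-suc : ∀ f j → partSeries f j ≈ ⟦ f 0 ⟧ + ∑ (upTo n) (λ x → ⟦ f (suc x) ⟧ * (q ^ j) ^ suc x)
  partSeries-suc f j = trans (∑-upTo-suc n _) (+-cong
    (trans (*-congˡ (reflexive (≡.cong (q ^_) (ℕ.*-zeroʳ j)))) (*-identityʳ _))
    (∑-cong (upTo n) λ x → *-congˡ (sym (^-assocʳ q j (suc x)))))

  partSeries-δ : ∀ j → partSeries δ j ≈ 1#
  partSeries-δ j = trans (partSeries-suc δ j) (trans
    (+-cong 1#-homo (∑-0 (upTo n) λ x → trans (*-congʳ 0#-homo) (zeroˡ _))) (+-identityʳ 1#))

  partSeries-χ : ∀ j → partSeries χ j ≈ geometric n ⟦ t ⟧ (q ^ j)
  partSeries-χ j = trans (partSeries-suc χ j) (trans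
    (+-cong 0#-homo (∑-cong (upTo n) λ x → *-congʳ (^-homo t x))) (+-identityˡ _))

  partSeries-ψ : ∀ j → partSeries ψ j ≈ 1# + ⟦ u ⟧ * geometric n ⟦ t ⟧ (q ^ j)
  partSeries-ψ j = trans (partSeries-suc ψ j) (+-cong 1#-homo (trans
    (∑-cong (upTo n) λ x → trans (*-congʳ (trans (*-homo _ _) (*-congˡ (^-homo t x)))) (*-assoc _ _ _))
    (sym (*-∑ (upTo n) ⟦ u ⟧ _))))

  vectorSeries : ∀ k → (Vec ℕ k → R.Carrier) → ℕ → Carrier
  vectorSeries k f o = ∑ (vectors k multiplicities) λ π → ⟦ f π ⟧ * q ^ weightFrom o π

  -- The weight is additive in the entries and `vectors` is a Cartesian product, so a multiplicative
  -- function on vectors has a product of series.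
  vectorSeries-∷ : ∀ k {f g h} o → (∀ x π → h (x Vec.∷ π) R.≈ f x R.* g π) →
    vectorSeries (suc k) h o ≈ partSeries f (suc o) * vectorSeries k g (suc o)
  vectorSeries-∷ k {f} {g} {h} o h≈f*g = begin
    vectorSeries (suc k) h o
      ≈⟨ ∑-cartesianProductWith Vec._∷_ multiplicities (vectors k multiplicities) _ ⟩
    ∑ multiplicities (λ x → ∑ (vectors k multiplicities) λ π →
      ⟦ h (x Vec.∷ π) ⟧ * q ^ (suc o ℕ.* x ℕ.+ weightFrom (suc o) π))
      ≈⟨ ∑-cong multiplicities (λ x → ∑-cong (vectors k multiplicities) λ π →
           trans (*-cong (trans (⟦⟧-cong (h≈f*g x π)) (*-homo _ _)) (^-homo-* q (suc o ℕ.* x) _))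
             (interchange _ _ _ _)) ⟩
    ∑ multiplicities (λ x → ∑ (vectors k multiplicities) λ π →
      (⟦ f x ⟧ * q ^ (suc o ℕ.* x)) * (⟦ g π ⟧ * q ^ weightFrom (suc o) π))
      ≈⟨ ∑-cong multiplicities (λ x → sym (*-∑ (vectors k multiplicities) _ _)) ⟩
    ∑ multiplicities (λ x → (⟦ f x ⟧ * q ^ (suc o ℕ.* x)) * vectorSeries k g (suc o))
      ≈⟨ sym (∑-* multiplicities _ _) ⟩
    partSeries f (suc o) * vectorSeries k g (suc o) ∎

  vectorSeries-empty : ∀ k o → vectorSeries k empty o ≈ 1#
  vectorSeries-empty zero    o = trans (+-identityʳ _) (trans (*-congʳ 1#-homo) (*-identityˡ 1#))
  vectorSeries-empty (suc k) o = begin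
    vectorSeries (suc k) empty o
      ≈⟨ vectorSeries-∷ k o (λ _ _ → R.refl) ⟩
    partSeries δ (suc o) * vectorSeries k empty (suc o)
      ≈⟨ *-cong (partSeries-δ (suc o)) (vectorSeries-empty k (suc o)) ⟩
    1# * 1#
      ≈⟨ *-identityˡ 1# ⟩
    1# ∎

  module _ (t≈1+u : ⟦ t ⟧ ≈ 1# + ⟦ u ⟧) (qᴺ≈0 : q ^ suc n ≈ 0#) where
    open WindowSums.Windows S n ⟦ t ⟧ ⟦ u ⟧ q t≈1+u qᴺ≈0

    -- Each clause of `w` splits off one factor: 1 for a skipped size, W inside the window, H for
    -- the largest part. The hypothesis says that the sizes still to come are `suc o` up to `n`.
    vectorSeries-w : ∀ k o r m → o ℕ.+ k ≡ n →
      vectorSeries k (w r m) o ≈ window (suc (o ℕ.+ r)) m * H (suc (o ℕ.+ r) ℕ.+ m)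
    vectorSeries-w zero o r m o+0≡n = begin
      ⟦ R.0# ⟧ * 1# + 0#        ≈⟨ trans (+-identityʳ _) (trans (*-identityʳ _) 0#-homo) ⟩
      0#                        ≈⟨ sym (zeroʳ _) ⟩
      -- The vector ends before the largest part is reached; correspondingly that part exceeds `o`,
      -- which is `n` here.
      window _ m * 0#           ≈⟨ *-congˡ (sym (H-vanishes (s≤s n≤))) ⟩
      window (suc (o ℕ.+ r)) m * H (suc (o ℕ.+ r) ℕ.+ m) ∎
      where
      n≤ : n ≤ o ℕ.+ r ℕ.+ m
      n≤ = ℕ.≤-trans (ℕ.≤-reflexive (≡.trans (≡.sym o+0≡n) (ℕ.+-identityʳ o)))
             (ℕ.≤-trans (ℕ.m≤m+n o r) (ℕ.m≤m+n _ m))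
    vectorSeries-w (suc k) o (suc r) m o+k≡n = begin
      vectorSeries (suc k) (w (suc r) m) o
        ≈⟨ vectorSeries-∷ k o (λ _ _ → R.refl) ⟩
      partSeries δ (suc o) * vectorSeries k (w r m) (suc o)
        ≈⟨ *-cong (partSeries-δ (suc o)) (vectorSeries-w k (suc o) r m (≡.trans (≡.sym (ℕ.+-suc o k)) o+k≡n)) ⟩
      1# * (window (suc (suc o ℕ.+ r)) m * H (suc (suc o ℕ.+ r) ℕ.+ m))
        ≈⟨ *-identityˡ _ ⟩
      window (suc (suc o ℕ.+ r)) m * H (suc (suc o ℕ.+ r) ℕ.+ m)
        ≈⟨ reflexive (≡.cong (λ i → window (suc i) m * H (suc i ℕ.+ m)) (≡.sym (ℕ.+-suc o r))) ⟩
      window (suc (o ℕ.+ suc r)) m * H (suc (o ℕ.+ suc r) ℕ.+ m) ∎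
    vectorSeries-w (suc k) o zero (suc m) o+k≡n rewrite ℕ.+-identityʳ o | ℕ.+-suc o m = begin
      vectorSeries (suc k) (w zero (suc m)) o
        ≈⟨ vectorSeries-∷ k o (λ _ _ → R.refl) ⟩
      partSeries ψ (suc o) * vectorSeries k (w zero m) (suc o)
        ≈⟨ *-cong (partSeries-ψ (suc o)) (vectorSeries-w k (suc o) zero m (≡.trans (≡.sym (ℕ.+-suc o k)) o+k≡n)) ⟩
      W (suc o) * (window (suc (suc o ℕ.+ 0)) m * H (suc (suc o ℕ.+ 0) ℕ.+ m))
        ≈⟨ sym (*-assoc _ _ _) ⟩
      W (suc o) * window (suc (suc o ℕ.+ 0)) m * H (suc (suc o ℕ.+ 0) ℕ.+ m)
        ≈⟨ reflexive (≡.cong (λ i → W (suc o) * window (suc (suc i)) m * H (suc (suc i) ℕ.+ m)) (ℕ.+-identityʳ o)) ⟩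
      W (suc o) * window (suc (suc o)) m * H (suc (suc o) ℕ.+ m) ∎
    vectorSeries-w (suc k) o zero zero o+k≡n rewrite ℕ.+-identityʳ o | ℕ.+-identityʳ o = begin
      vectorSeries (suc k) (w zero zero) o
        ≈⟨ vectorSeries-∷ k o (λ _ _ → R.refl) ⟩
      partSeries χ (suc o) * vectorSeries k empty (suc o)
        ≈⟨ *-cong (partSeries-χ (suc o)) (vectorSeries-empty k (suc o)) ⟩
      H (suc o) * 1#
        ≈⟨ *-comm _ _ ⟩
      1# * H (suc o) ∎

-- The statistics of a partition under prepending a multiplicity.

filter-map : ∀ {A B : Set} {p} {P : Pred B p} (P? : Decidable P) (f : A → B) xs →
             filter P? (map f xs) ≡ map f (filter (P? ∘ f) xs)
filter-map P? f []       = refl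
filter-map P? f (x ∷ xs) with does (P? (f x))
... | true  = ≡.cong (f x ∷_) (filter-map P? f xs)
... | false = filter-map P? f xs

parts-tail : ∀ {n} x (π : Vec ℕ n) →
  map (suc ∘ Fin.toℕ) (filter (λ i → 0 ℕ.<? Vec.lookup (x Vec.∷ π) i) (tabulate Fin.suc)) ≡ map suc (parts π)
parts-tail {n} x π = begin
  map (suc ∘ Fin.toℕ) (filter positive? (tabulate Fin.suc))
    ≡⟨ ≡.cong (map (suc ∘ Fin.toℕ) ∘ filter positive?) (≡.sym (map-tabulate id Fin.suc)) ⟩
  map (suc ∘ Fin.toℕ) (filter positive? (map Fin.suc (allFin n)))
    ≡⟨ ≡.cong (map (suc ∘ Fin.toℕ)) (filter-map positive? Fin.suc (allFin n)) ⟩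
  map (suc ∘ Fin.toℕ) (map Fin.suc (filter (positive? ∘ Fin.suc) (allFin n)))
    ≡⟨ ≡.sym (map-∘ (filter (positive? ∘ Fin.suc) (allFin n))) ⟩
  map (suc ∘ suc ∘ Fin.toℕ) (filter (positive? ∘ Fin.suc) (allFin n))
    ≡⟨ map-∘ (filter (positive? ∘ Fin.suc) (allFin n)) ⟩
  map suc (parts π) ∎
  where
  open ≡.≡-Reasoning
  positive? : Decidable (λ i → 0 ℕ.< Vec.lookup (x Vec.∷ π) i)
  positive? i = 0 ℕ.<? Vec.lookup (x Vec.∷ π) i

parts-0∷ : ∀ {n} (π : Vec ℕ n) → parts (0 Vec.∷ π) ≡ map suc (parts π)
parts-0∷ = parts-tail 0

parts-suc∷ : ∀ {n} x (π : Vec ℕ n) → parts (suc x Vec.∷ π) ≡ 1 ∷ map suc (parts π)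
parts-suc∷ x π = ≡.cong (1 ∷_) (parts-tail (suc x) π)

Q-0∷ : ∀ {n} (π : Vec ℕ n) → Q (0 Vec.∷ π) ≡ Q π
Q-0∷ π = ≡.trans (≡.cong length (parts-0∷ π)) (length-map suc (parts π))

Q-suc∷ : ∀ {n} x (π : Vec ℕ n) → Q (suc x Vec.∷ π) ≡ suc (Q π)
Q-suc∷ x π = ≡.trans (≡.cong length (parts-suc∷ x π)) (≡.cong suc (length-map suc (parts π)))

s≡foldr : ∀ {n} (π : Vec ℕ n) → s π ≡ foldr ℕ._⊓_ n (parts π)
s≡foldr {n} π = min≡foldr (parts π)
  where
  min≡foldr : ∀ xs → min n xs ≡ foldr ℕ._⊓_ n xs
  min≡foldr []       = refl
  min≡foldr (x ∷ xs) = ≡.trans min-∷ (≡.cong (x ℕ.⊓_) (min≡foldr xs))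
    where
    min-∷ : min n (x ∷ xs) ≡ x ℕ.⊓ min n xs
    -- `min` selects by `ℕ.≤-total`; splitting on the same comparison lets it reduce.
    min-∷ with ℕ.≤-total x (min n xs)
    ... | inj₁ x≤m = ≡.sym (ℕ.m≤n⇒m⊓n≡m x≤m)
    ... | inj₂ m≤x = ≡.sym (ℕ.m≥n⇒m⊓n≡n m≤x)

l≡foldr : ∀ {n} (π : Vec ℕ n) → l π ≡ foldr ℕ._⊔_ 0 (parts π)
l≡foldr π = max≡foldr (parts π)
  where
  max≡foldr : ∀ xs → max 0 xs ≡ foldr ℕ._⊔_ 0 xs
  max≡foldr []       = refl
  max≡foldr (x ∷ xs) = ≡.trans max-∷ (≡.cong (x ℕ.⊔_) (max≡foldr xs))
    where
    max-∷ : max 0 (x ∷ xs) ≡ x ℕ.⊔ max 0 xs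
    max-∷ with ℕ.≤-total (max 0 xs) x
    ... | inj₁ m≤x = ≡.sym (ℕ.m≥n⇒m⊔n≡m m≤x)
    ... | inj₂ x≤m = ≡.sym (ℕ.m≤n⇒m⊔n≡n x≤m)

-- The default moves up together with the entries, just as the default in `s` does when the vector
-- gets longer, so the empty list is no exception.
foldr-⊓-suc : ∀ n xs → foldr ℕ._⊓_ (suc n) (map suc xs) ≡ suc (foldr ℕ._⊓_ n xs)
foldr-⊓-suc n []       = refl
foldr-⊓-suc n (x ∷ xs) = ≡.cong (suc x ℕ.⊓_) (foldr-⊓-suc n xs)

-- The default 0 stays put, so the empty list would give 0 on the left and 1 on the right. This is
-- why `l-0∷` asks for a nonempty partition.
foldr-⊔-suc : ∀ xs → xs ≢ [] → foldr ℕ._⊔_ 0 (map suc xs) ≡ suc (foldr ℕ._⊔_ 0 xs)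
foldr-⊔-suc []           xs≢[] = contradiction refl xs≢[]
foldr-⊔-suc (x ∷ [])     _     = ≡.cong suc (≡.sym (ℕ.⊔-identityʳ x))
foldr-⊔-suc (x ∷ y ∷ xs) _     = ≡.cong (suc x ℕ.⊔_) (foldr-⊔-suc (y ∷ xs) λ ())

-- A part 1 in front makes up for the fixed default: the empty list now gives 1 on both sides.
1⊔foldr-⊔-suc : ∀ xs → 1 ℕ.⊔ foldr ℕ._⊔_ 0 (map suc xs) ≡ suc (foldr ℕ._⊔_ 0 xs)
1⊔foldr-⊔-suc []       = refl
1⊔foldr-⊔-suc (x ∷ xs) = ≡.cong (1 ℕ.⊔_) (foldr-⊔-suc (x ∷ xs) λ ())

s-0∷ : ∀ {n} (π : Vec ℕ n) → s (0 Vec.∷ π) ≡ suc (s π)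
s-0∷ {n} π = begin
  s (0 Vec.∷ π)                               ≡⟨ s≡foldr (0 Vec.∷ π) ⟩
  foldr ℕ._⊓_ (suc n) (parts (0 Vec.∷ π))     ≡⟨ ≡.cong (foldr ℕ._⊓_ (suc n)) (parts-0∷ π) ⟩
  foldr ℕ._⊓_ (suc n) (map suc (parts π))     ≡⟨ foldr-⊓-suc n (parts π) ⟩
  suc (foldr ℕ._⊓_ n (parts π))               ≡⟨ ≡.cong suc (s≡foldr π) ⟨
  suc (s π)                                   ∎
  where open ≡.≡-Reasoning

s-suc∷ : ∀ {n} x (π : Vec ℕ n) → s (suc x Vec.∷ π) ≡ 1
s-suc∷ {n} x π = begin
  s (suc x Vec.∷ π)                                 ≡⟨ s≡foldr (suc x Vec.∷ π) ⟩
  foldr ℕ._⊓_ (suc n) (parts (suc x Vec.∷ π))       ≡⟨ ≡.cong (foldr ℕ._⊓_ (suc n)) (parts-suc∷ x π) ⟩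
  1 ℕ.⊓ foldr ℕ._⊓_ (suc n) (map suc (parts π))     ≡⟨ ≡.cong (1 ℕ.⊓_) (foldr-⊓-suc n (parts π)) ⟩
  1                                                 ∎
  where open ≡.≡-Reasoning

parts≡[]⇒k≡0 : ∀ {n} (π : Vec ℕ n) → parts π ≡ [] → k π ≡ 0
parts≡[]⇒k≡0 Vec.[]            _  = refl
parts≡[]⇒k≡0 (zero  Vec.∷ π) eq = parts≡[]⇒k≡0 π (map≡[] (parts π) (≡.trans (≡.sym (parts-0∷ π)) eq))
  where
  map≡[] : ∀ xs → map suc xs ≡ [] → xs ≡ []
  map≡[] [] _ = refl

k≡0⇒parts≡[] : ∀ {n} (π : Vec ℕ n) → k π ≡ 0 → parts π ≡ []
k≡0⇒parts≡[] Vec.[]          _   = refl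
k≡0⇒parts≡[] (zero Vec.∷ π) k≡0 = ≡.trans (parts-0∷ π) (≡.cong (map suc) (k≡0⇒parts≡[] π k≡0))

l-0∷ : ∀ {n} (π : Vec ℕ n) → k π ≢ 0 → l (0 Vec.∷ π) ≡ suc (l π)
l-0∷ π k≢0 = begin
  l (0 Vec.∷ π)                           ≡⟨ l≡foldr (0 Vec.∷ π) ⟩
  foldr ℕ._⊔_ 0 (parts (0 Vec.∷ π))       ≡⟨ ≡.cong (foldr ℕ._⊔_ 0) (parts-0∷ π) ⟩
  foldr ℕ._⊔_ 0 (map suc (parts π))       ≡⟨ foldr-⊔-suc (parts π) (k≢0 ∘ parts≡[]⇒k≡0 π) ⟩
  suc (foldr ℕ._⊔_ 0 (parts π))           ≡⟨ ≡.cong suc (l≡foldr π) ⟨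
  suc (l π)                               ∎
  where open ≡.≡-Reasoning

l-suc∷ : ∀ {n} x (π : Vec ℕ n) → l (suc x Vec.∷ π) ≡ suc (l π)
l-suc∷ x π = begin
  l (suc x Vec.∷ π)                             ≡⟨ l≡foldr (suc x Vec.∷ π) ⟩
  foldr ℕ._⊔_ 0 (parts (suc x Vec.∷ π))         ≡⟨ ≡.cong (foldr ℕ._⊔_ 0) (parts-suc∷ x π) ⟩
  1 ℕ.⊔ foldr ℕ._⊔_ 0 (map suc (parts π))       ≡⟨ 1⊔foldr-⊔-suc (parts π) ⟩
  suc (foldr ℕ._⊔_ 0 (parts π))                 ≡⟨ ≡.cong suc (l≡foldr π) ⟨
  suc (l π)                                     ∎
  where open ≡.≡-Reasoning

Q-positive : ∀ {n} (π : Vec ℕ n) → k π ≢ 0 → Q π ≢ 0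
Q-positive π k≢0 with parts π in eq
... | []    = contradiction (parts≡[]⇒k≡0 π eq) k≢0
... | _ ∷ _ = λ ()

s≤l : ∀ {n} (π : Vec ℕ n) → k π ≢ 0 → s π ≤ l π
s≤l Vec.[]            k≢0 = contradiction refl k≢0
s≤l (zero  Vec.∷ π) k≢0 =
  ≡.subst₂ _≤_ (≡.sym (s-0∷ π)) (≡.sym (l-0∷ π k≢0)) (s≤s (s≤l π k≢0))
s≤l (suc x Vec.∷ π) _   =
  ≡.subst₂ _≤_ (≡.sym (s-suc∷ x π)) (≡.sym (l-suc∷ x π)) (s≤s z≤n)

weight≡weightFrom : ∀ {n} (π : Vec ℕ n) → weight π ≡ weightFrom 0 π
weight≡weightFrom π = ≡.trans
  (≡.cong sum (map-tabulate id (λ i → suc (Fin.toℕ i) ℕ.* Vec.lookup π i))) (sum-tabulate 0 π)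
  where
  sum-tabulate : ∀ {n} o (π : Vec ℕ n) →
    sum (tabulate (λ i → suc (o ℕ.+ Fin.toℕ i) ℕ.* Vec.lookup π i)) ≡ weightFrom o π
  sum-tabulate o Vec.[]      = refl
  sum-tabulate o (x Vec.∷ π) = ≡.cong₂ ℕ._+_
    (≡.cong (λ j → suc j ℕ.* x) (ℕ.+-identityʳ o))
    (≡.trans (≡.cong sum (tabulate-cong λ i → ≡.cong (λ j → suc j ℕ.* Vec.lookup π i) (ℕ.+-suc o (Fin.toℕ i))))
             (sum-tabulate (suc o) π))

weightFrom-0 : ∀ {n} o (π : Vec ℕ n) → k π ≡ 0 → weightFrom o π ≡ 0
weightFrom-0 o Vec.[]          _   = refl
weightFrom-0 o (zero Vec.∷ π) k≡0 = ≡.cong₂ ℕ._+_ (ℕ.*-zeroʳ o) (weightFrom-0 (suc o) π k≡0)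

-- The summand of a partition as a double sum of weights.

module PartitionWeights {c ℓ} (R : CommutativeRing c ℓ) (t u v : CommutativeRing.Carrier R)
  (t*v≈u : CommutativeRing._≈_ R (CommutativeRing._*_ R t v) u) where
  open CommutativeRing R hiding (refl; zero)
  open CommutativeRing R using () renaming (refl to ≈-refl)
  open import Algebra.Properties.Semiring.Exp semiring using (_^_; ^-homo-*)
  open import Algebra.Solver.Ring.NaturalCoefficients.Default commutativeSemiring
  open import Relation.Binary.Reasoning.Setoid setoid
  open Sums R
  open VectorWeights R t u

  coefficient : ∀ {n} → Vec ℕ n → Carrier
  coefficient π = t ^ (k π ∸ 1) * v ^ (Q π ∸ 1)

  blockSum : (ℕ → Carrier) → ∀ {n} → Vec ℕ n → Carrier
  blockSum a π = ∑ [1‥ s π ] λ j → a (l π ∸ s π ℕ.+ j)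

  coefficient-0∷ : ∀ {n} (π : Vec ℕ n) → coefficient (0 Vec.∷ π) ≈ coefficient π
  coefficient-0∷ π = reflexive (≡.cong (λ i → t ^ (k π ∸ 1) * v ^ (i ∸ 1)) (Q-0∷ π))

  coefficient-suc∷ : ∀ {n} x (π : Vec ℕ n) → coefficient (suc x Vec.∷ π) ≈ t ^ (x ℕ.+ k π) * v ^ Q π
  coefficient-suc∷ x π = reflexive (≡.cong (λ i → t ^ (x ℕ.+ k π) * v ^ (i ∸ 1)) (Q-suc∷ x π))

  -- A part with nothing above it is the largest one, and it absorbs the `∸ 1` of both exponents.
  coefficient-suc∷0 : ∀ {n} x (π : Vec ℕ n) → k π ≡ 0 → coefficient (suc x Vec.∷ π) ≈ t ^ x
  coefficient-suc∷0 x π k≡0 = trans (coefficient-suc∷ x π) (trans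
    (*-cong (reflexive (≡.cong (t ^_) (≡.trans (≡.cong (x ℕ.+_) k≡0) (ℕ.+-identityʳ x))))
            (reflexive (≡.cong (λ ps → v ^ length ps) (k≡0⇒parts≡[] π k≡0))))
    (*-identityʳ _))

  -- A part below the largest, of multiplicity `suc x`, contributes t^(x+1) · v = u · t^x.
  coefficient-suc∷≢0 : ∀ {n} x (π : Vec ℕ n) → k π ≢ 0 →
                       coefficient (suc x Vec.∷ π) ≈ u * t ^ x * coefficient π
  coefficient-suc∷≢0 x π k≢0 = trans (coefficient-suc∷ x π) (split (k π) (Q π) k≢0 (Q-positive π k≢0))
    where
    split : ∀ i j → i ≢ 0 → j ≢ 0 → t ^ (x ℕ.+ i) * v ^ j ≈ u * t ^ x * (t ^ (i ∸ 1) * v ^ (j ∸ 1))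
    split zero    _       i≢0 _   = contradiction refl i≢0
    split (suc i) zero    _   j≢0 = contradiction refl j≢0
    split (suc i) (suc j) _   _   = begin
      t ^ (x ℕ.+ suc i) * (v * v ^ j)
        ≈⟨ *-congʳ (^-homo-* t x (suc i)) ⟩
      t ^ x * (t * t ^ i) * (v * v ^ j)
        ≈⟨ solve 5 (λ a t b v c → a :* (t :* b) :* (v :* c) := t :* v :* a :* (b :* c)) ≈-refl _ _ _ _ _ ⟩
      t * v * t ^ x * (t ^ i * v ^ j)
        ≈⟨ *-congʳ (*-congʳ t*v≈u) ⟩
      u * t ^ x * (t ^ i * v ^ j) ∎

  empty-0 : ∀ {n} (π : Vec ℕ n) → k π ≡ 0 → empty π ≈ 1#
  empty-0 Vec.[]          _   = ≈-refl
  empty-0 (zero Vec.∷ π) k≡0 = trans (*-identityˡ _) (empty-0 π k≡0)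

  empty-≢0 : ∀ {n} (π : Vec ℕ n) → k π ≢ 0 → empty π ≈ 0#
  empty-≢0 Vec.[]           k≢0 = contradiction refl k≢0
  empty-≢0 (zero  Vec.∷ π) k≢0 = trans (*-congˡ (empty-≢0 π k≢0)) (zeroʳ _)
  empty-≢0 (suc x Vec.∷ π) k≢0 = zeroˡ _

  w-0 : ∀ {n} m (π : Vec ℕ n) → k π ≡ 0 → w 0 m π ≈ 0#
  w-0 m       Vec.[]          _   = ≈-refl
  w-0 zero    (zero Vec.∷ π) _   = zeroˡ _
  w-0 (suc m) (zero Vec.∷ π) k≡0 = trans (*-congˡ (w-0 m π k≡0)) (zeroʳ _)

  -- Only the term with `suc m` equal to `l π` survives, and `n ≤ M` keeps it in range. The sequence
  -- `b` is general because the tail sees it shifted by one.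
  ∑-w-0 : ∀ {n} M (b : ℕ → Carrier) (π : Vec ℕ n) → n ≤ M → k π ≢ 0 →
          ∑ (upTo M) (λ m → b (suc m) * w 0 m π) ≈ coefficient π * b (l π)
  ∑-w-0 M b Vec.[] _ k≢0 = contradiction refl k≢0
  ∑-w-0 (suc M) b (zero Vec.∷ π) (s≤s n≤M) k≢0 = begin
    ∑ (upTo (suc M)) (λ m → b (suc m) * w 0 m (0 Vec.∷ π))
      ≈⟨ ∑-upTo-suc M _ ⟩
    b 1 * (0# * empty π) + ∑ (upTo M) (λ m → b (suc (suc m)) * (1# * w 0 m π))
      ≈⟨ +-cong (trans (*-congˡ (zeroˡ _)) (zeroʳ _)) (∑-cong (upTo M) λ m → *-congˡ (*-identityˡ _)) ⟩
    0# + ∑ (upTo M) (λ m → b (suc (suc m)) * w 0 m π)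
      ≈⟨ trans (+-identityˡ _) (∑-w-0 M (b ∘ suc) π n≤M k≢0) ⟩
    coefficient π * b (suc (l π))
      ≈⟨ *-cong (sym (coefficient-0∷ π)) (reflexive (≡.cong b (≡.sym (l-0∷ π k≢0)))) ⟩
    coefficient (0 Vec.∷ π) * b (l (0 Vec.∷ π)) ∎
  ∑-w-0 (suc M) b (suc x Vec.∷ π) (s≤s n≤M) _ = begin
    ∑ (upTo (suc M)) (λ m → b (suc m) * w 0 m (suc x Vec.∷ π))
      ≈⟨ ∑-upTo-suc M _ ⟩
    b 1 * (t ^ x * empty π) + ∑ (upTo M) (λ m → b (suc (suc m)) * (u * t ^ x * w 0 m π))
      -- The first size is the largest part exactly if the tail is empty; accordingly either the
      -- head term or the remaining sum vanishes.
      ≈⟨ by-tail (k π ℕ.≟ 0) ⟩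
    coefficient (suc x Vec.∷ π) * b (suc (l π))
      ≈⟨ *-congˡ (reflexive (≡.cong b (≡.sym (l-suc∷ x π)))) ⟩
    coefficient (suc x Vec.∷ π) * b (l (suc x Vec.∷ π)) ∎
    where
    by-tail : Dec (k π ≡ 0) →
      b 1 * (t ^ x * empty π) + ∑ (upTo M) (λ m → b (suc (suc m)) * (u * t ^ x * w 0 m π))
      ≈ coefficient (suc x Vec.∷ π) * b (suc (l π))
    by-tail (yes k≡0) = begin
      b 1 * (t ^ x * empty π) + ∑ (upTo M) (λ m → b (suc (suc m)) * (u * t ^ x * w 0 m π))
        ≈⟨ +-cong (*-congˡ (trans (*-congˡ (empty-0 π k≡0)) (*-identityʳ _)))
             (∑-0 (upTo M) λ m → trans (*-congˡ (trans (*-congˡ (w-0 m π k≡0)) (zeroʳ _))) (zeroʳ _)) ⟩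
      b 1 * t ^ x + 0#
        ≈⟨ trans (+-identityʳ _) (*-comm _ _) ⟩
      t ^ x * b 1
        ≈⟨ *-cong (sym (coefficient-suc∷0 x π k≡0)) (reflexive (≡.cong (b ∘ suc) (≡.sym l≡0))) ⟩
      coefficient (suc x Vec.∷ π) * b (suc (l π)) ∎
      where
      l≡0 : l π ≡ 0
      l≡0 = ≡.cong (max 0) (k≡0⇒parts≡[] π k≡0)
    by-tail (no k≢0) = begin
      b 1 * (t ^ x * empty π) + ∑ (upTo M) (λ m → b (suc (suc m)) * (u * t ^ x * w 0 m π))
        ≈⟨ +-cong (trans (*-congˡ (trans (*-congˡ (empty-≢0 π k≢0)) (zeroʳ _))) (zeroʳ _))
             (trans (∑-cong (upTo M) λ m → solve 3 (λ a b c → a :* (b :* c) := b :* (a :* c)) ≈-refl _ _ _)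
               (sym (*-∑ (upTo M) _ _))) ⟩
      0# + u * t ^ x * ∑ (upTo M) (λ m → b (suc (suc m)) * w 0 m π)
        ≈⟨ trans (+-identityˡ _) (*-congˡ (∑-w-0 M (b ∘ suc) π n≤M k≢0)) ⟩
      u * t ^ x * (coefficient π * b (suc (l π)))
        ≈⟨ sym (*-assoc _ _ _) ⟩
      u * t ^ x * coefficient π * b (suc (l π))
        ≈⟨ *-congʳ (sym (coefficient-suc∷≢0 x π k≢0)) ⟩
      coefficient (suc x Vec.∷ π) * b (suc (l π)) ∎

  -- Moving all parts up by one keeps l - s and raises s, so the block of indices gains its new top
  -- element.
  blockSum-0∷ : ∀ a {n} (π : Vec ℕ n) → k π ≢ 0 → blockSum a (0 Vec.∷ π) ≈ blockSum a π + a (l (0 Vec.∷ π))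
  blockSum-0∷ a π k≢0 = begin
    blockSum a (0 Vec.∷ π)
      ≈⟨ reflexive (≡.cong₂ (λ s l → ∑ [1‥ s ] λ j → a (l ∸ s ℕ.+ j)) (s-0∷ π) (l-0∷ π k≢0)) ⟩
    ∑ [1‥ suc (s π) ] (λ j → a (l π ∸ s π ℕ.+ j))
      ≈⟨ ∑-map suc (upTo (suc (s π))) _ ⟩
    ∑ (upTo (suc (s π))) (λ j → a (l π ∸ s π ℕ.+ suc j))
      ≈⟨ ∑-upTo-sucʳ (s π) _ ⟩
    ∑ (upTo (s π)) (λ j → a (l π ∸ s π ℕ.+ suc j)) + a (l π ∸ s π ℕ.+ suc (s π))
      ≈⟨ +-cong (sym (∑-map suc (upTo (s π)) _)) (reflexive (≡.cong a last)) ⟩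
    blockSum a π + a (l (0 Vec.∷ π)) ∎
    where
    last : l π ∸ s π ℕ.+ suc (s π) ≡ l (0 Vec.∷ π)
    last = ≡.trans (ℕ.+-suc _ _) (≡.trans (≡.cong suc (ℕ.m∸n+n≡m (s≤l π k≢0))) (≡.sym (l-0∷ π k≢0)))

  blockSum-suc∷ : ∀ a {n} x (π : Vec ℕ n) → blockSum a (suc x Vec.∷ π) ≈ a (l (suc x Vec.∷ π))
  blockSum-suc∷ a x π = begin
    blockSum a (suc x Vec.∷ π)
      ≈⟨ reflexive (≡.cong₂ (λ s l → ∑ [1‥ s ] λ j → a (l ∸ s ℕ.+ j)) (s-suc∷ x π) (l-suc∷ x π)) ⟩
    a (l π ℕ.+ 1) + 0#
      ≈⟨ +-identityʳ _ ⟩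
    a (l π ℕ.+ 1)
      ≈⟨ reflexive (≡.cong a (≡.trans (ℕ.+-comm (l π) 1) (≡.sym (l-suc∷ x π)))) ⟩
    a (l (suc x Vec.∷ π)) ∎

  -- Nonzero weights have r < s and m + 1 = l - r, so `suc m` descends through the block from l to l
  -- - s + 1. In the induction over leading zeros, r = 0 yields the top index and r > 0 the block of
  -- the tail; once a part 1 occurs, only r = 0 is left.
  ∑-w : ∀ {n} N M (a : ℕ → Carrier) (π : Vec ℕ n) → n ≤ N → n ≤ M → k π ≢ 0 →
        ∑ (upTo N) (λ r → ∑ (upTo M) (λ m → a (suc m) * w r m π)) ≈ coefficient π * blockSum a π
  ∑-w N M a Vec.[] _ _ k≢0 = contradiction refl k≢0
  ∑-w (suc N) M a π@(zero Vec.∷ π′) (s≤s n≤N) n≤M k≢0 = begin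
    ∑ (upTo (suc N)) (λ r → ∑ (upTo M) (λ m → a (suc m) * w r m π))
      ≈⟨ ∑-upTo-suc N _ ⟩
    ∑ (upTo M) (λ m → a (suc m) * w 0 m π) +
      ∑ (upTo N) (λ r → ∑ (upTo M) (λ m → a (suc m) * (1# * w r m π′)))
      ≈⟨ +-cong (∑-w-0 M a π n≤M k≢0) (trans
           (∑-cong (upTo N) λ r → ∑-cong (upTo M) λ m → *-congˡ (*-identityˡ _))
           (∑-w N M a π′ n≤N (ℕ.≤-trans (ℕ.n≤1+n _) n≤M) k≢0)) ⟩
    coefficient π * a (l π) + coefficient π′ * blockSum a π′
      ≈⟨ +-congˡ (*-congʳ (sym (coefficient-0∷ π′))) ⟩
    coefficient π * a (l π) + coefficient π * blockSum a π′
      ≈⟨ trans (+-comm _ _) (sym (distribˡ _ _ _)) ⟩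
    coefficient π * (blockSum a π′ + a (l π))
      ≈⟨ *-congˡ (sym (blockSum-0∷ a π′ k≢0)) ⟩
    coefficient π * blockSum a π ∎
  ∑-w (suc N) M a π@(suc x Vec.∷ π′) _ n≤M k≢0 = begin
    ∑ (upTo (suc N)) (λ r → ∑ (upTo M) (λ m → a (suc m) * w r m π))
      ≈⟨ ∑-upTo-suc N _ ⟩
    ∑ (upTo M) (λ m → a (suc m) * w 0 m π) +
      ∑ (upTo N) (λ r → ∑ (upTo M) (λ m → a (suc m) * (0# * w r m π′)))
      ≈⟨ +-cong (∑-w-0 M a π n≤M k≢0)
           (∑-0 (upTo N) λ r → ∑-0 (upTo M) λ m → trans (*-congˡ (zeroˡ _)) (zeroʳ _)) ⟩
    coefficient π * a (l π) + 0#
      ≈⟨ trans (+-identityʳ _) (*-congˡ (sym (blockSum-suc∷ a x π′))) ⟩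
    coefficient π * blockSum a π ∎

-- Unrolling the recurrence.

module DivisorSums {c ℓ} (R : CommutativeRing c ℓ) (t : CommutativeRing.Carrier R) where
  open CommutativeRing R hiding (refl; zero)
  open CommutativeRing R using () renaming (refl to ≈-refl)
  open import Algebra.Properties.Semiring.Exp semiring using (_^_)
  open import Algebra.Solver.Ring.NaturalCoefficients.Default commutativeSemiring
  open import Relation.Binary.Reasoning.Setoid setoid
  open Sums R

  recurrence-head : ∀ n (κ d : ℕ → Carrier) → (∀ m → d m ≈ κ m + t * d (suc m)) → d n ≈ 0# →
                    d 0 ≈ ∑ (upTo n) (λ e → κ e * t ^ e)
  recurrence-head zero    κ d d-rec dn≈0 = dn≈0
  recurrence-head (suc n) κ d d-rec dn≈0 = begin
    d 0
      ≈⟨ d-rec 0 ⟩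
    κ 0 + t * d 1
      ≈⟨ +-cong (sym (*-identityʳ _)) (*-congˡ (recurrence-head n (κ ∘ suc) (d ∘ suc) (d-rec ∘ suc) dn≈0)) ⟩
    κ 0 * 1# + t * ∑ (upTo n) (λ e → κ (suc e) * t ^ e)
      ≈⟨ +-congˡ (trans (*-∑ (upTo n) t _)
           (∑-cong (upTo n) λ e → solve 3 (λ t a b → t :* (a :* b) := a :* (t :* b)) ≈-refl _ _ _)) ⟩
    κ 0 * 1# + ∑ (upTo n) (λ e → κ (suc e) * t ^ suc e)
      ≈⟨ sym (∑-upTo-suc n _) ⟩
    ∑ (upTo (suc n)) (λ e → κ e * t ^ e) ∎

  -- In effect d m = ∑_{e ≥ m} κ e · t^(e-m) is substituted and the sums are exchanged; the
  -- induction removes `b 0`, whose share is `recurrence-head`.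
  ∑-recurrence : ∀ n (b κ d : ℕ → Carrier) → (∀ m → d m ≈ κ m + t * d (suc m)) → d n ≈ 0# →
    ∑ (upTo n) (λ m → b m * d m) ≈ ∑ (upTo n) (λ e → κ e * ∑ (upTo (suc e)) (λ i → b i * t ^ (e ∸ i)))
  ∑-recurrence zero    b κ d d-rec dn≈0 = ≈-refl
  ∑-recurrence (suc n) b κ d d-rec dn≈0 = begin
    ∑ (upTo (suc n)) (λ m → b m * d m)
      ≈⟨ ∑-upTo-suc n _ ⟩
    b 0 * d 0 + ∑ (upTo n) (λ m → b (suc m) * d (suc m))
      ≈⟨ +-cong
           (trans (*-congˡ (recurrence-head (suc n) κ d d-rec dn≈0)) (trans (*-∑ (upTo (suc n)) _ _)
             (∑-cong (upTo (suc n)) λ e → solve 3 (λ b k x → b :* (k :* x) := k :* (b :* x)) ≈-refl _ _ _)))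
           (trans (∑-recurrence n (b ∘ suc) (κ ∘ suc) (d ∘ suc) (d-rec ∘ suc) dn≈0)
             -- `later 0` is `κ 0` times an empty sum, so prepending it aligns the two ranges at no
             -- cost.
             (trans (sym (trans (+-congʳ (zeroʳ (κ 0))) (+-identityˡ _))) (sym (∑-upTo-suc n later)))) ⟩
    ∑ (upTo (suc n)) (λ e → κ e * (b 0 * t ^ e)) + ∑ (upTo (suc n)) later
      ≈⟨ sym (∑-+ (upTo (suc n)) _ later) ⟩
    ∑ (upTo (suc n)) (λ e → κ e * (b 0 * t ^ e) + later e)
      ≈⟨ ∑-cong (upTo (suc n)) (λ e → trans (sym (distribˡ (κ e) _ _)) (*-congˡ (sym (∑-upTo-suc e _)))) ⟩
    ∑ (upTo (suc n)) (λ e → κ e * ∑ (upTo (suc e)) (λ i → b i * t ^ (e ∸ i))) ∎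
    where
    later : ℕ → Carrier
    later e = κ e * ∑ (upTo e) (λ i → b (suc i) * t ^ (e ∸ suc i))

-- Comparing coefficients of qⁿ, with `X` as q.

module PartitionIdentity {c ℓ} (R : CommutativeRing c ℓ) (t u v : CommutativeRing.Carrier R)
  (t≈1+u : CommutativeRing._≈_ R t (CommutativeRing._+_ R (CommutativeRing.1# R) u))
  (t*v≈u : CommutativeRing._≈_ R (CommutativeRing._*_ R t v) u)
  (n : ℕ) (n≢0 : n ≢ 0) where
  open CommutativeRing R hiding (refl; zero)
  open CommutativeRing R using () renaming (refl to ≈-refl)
  open import Algebra.Properties.Semiring.Exp semiring using (_^_; ^-homo-*)
  open import Algebra.Solver.Ring.NaturalCoefficients.Default commutativeSemiring
  open import Relation.Binary.Reasoning.Setoid setoid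
  open Sums R
  open Series R
  open VectorWeights R t u
  open PartitionWeights R t u v t*v≈u

  S : CommutativeRing c ℓ
  S = truncated n

  private
    module S = CommutativeRing S
    module ∑ˢ = Sums S
    open import Algebra.Properties.Semiring.Exp S.semiring using () renaming (_^_ to _^ˢ_; ^-assocʳ to ^ˢ-assocʳ)

  X^-coefficient : ∀ j m → (X ^ˢ j) m ≈ [ j ℕ.≟ m ]
  X^-coefficient zero    zero    = ≈-refl
  X^-coefficient zero    (suc m) = ≈-refl
  X^-coefficient (suc j) zero    = zeroˡ _
  X^-coefficient (suc j) (suc m) = trans (X-⊛-suc (X ^ˢ j) m) (X^-coefficient j m)

  ∑ˢ-coefficient : ∀ {A : Set} (xs : List A) f m → ∑ˢ.∑ xs f m ≈ ∑ xs (λ x → f x m)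
  ∑ˢ-coefficient []       f m = ≈-refl
  ∑ˢ-coefficient (x ∷ xs) f m = +-congˡ (∑ˢ-coefficient xs f m)

  X^N≈0 : X ^ˢ suc n S.≈ S.0#
  X^N≈0 m m≤n = trans (X^-coefficient (suc n) m)
    ([no] (suc n ℕ.≟ m) λ { refl → ℕ.<-irrefl refl m≤n })

  constant-t≈1+u : constant t S.≈ S.1# S.+ constant u
  constant-t≈1+u zero    _ = t≈1+u
  constant-t≈1+u (suc m) _ = sym (+-identityˡ 0#)

  open WindowSums S using (geometric)
  open WindowSums.Windows S n (constant t) (constant u) X constant-t≈1+u X^N≈0
    using (window; H; D; D-rec; D-vanishes; geometric-q)
  open GeneratingFunction R S constant (constant-isRingHomomorphism n) n t u X
    using (vectorSeries; vectorSeries-w)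

  -- Filtering the vectors by weight is the same as extracting the coefficient of degree `n` from
  -- the series over all of them.
  ∑-P : ∀ f → ∑ (P n) f ≈ vectorSeries n f 0 n
  ∑-P f = begin
    ∑ (P n) f
      ≈⟨ ∑-filter (λ π → weight π ℕ.≟ n) (vectors n (upTo (suc n))) f ⟩
    ∑ (vectors n (upTo (suc n))) (λ π → [ weight π ℕ.≟ n ] * f π)
      ≈⟨ ∑-cong (vectors n (upTo (suc n))) (λ π → trans (*-comm _ _) (*-congˡ
           (trans (reflexive (≡.cong (λ j → [ j ℕ.≟ n ]) (weight≡weightFrom π)))
             (sym (X^-coefficient (weightFrom 0 π) n))))) ⟩
    ∑ (vectors n (upTo (suc n))) (λ π → f π * (X ^ˢ weightFrom 0 π) n)
      ≈⟨ ∑-cong (vectors n (upTo (suc n))) (λ π → sym (constant-⊛ (f π) (X ^ˢ weightFrom 0 π) n)) ⟩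
    ∑ (vectors n (upTo (suc n))) (λ π → (constant (f π) ⊛ (X ^ˢ weightFrom 0 π)) n)
      ≈⟨ sym (∑ˢ-coefficient (vectors n (upTo (suc n))) _ n) ⟩
    vectorSeries n f 0 n ∎

  ∑-P-w : ∀ m → ∑ (upTo (suc n)) (λ r → ∑ (P n) (w r m)) ≈ D m n
  ∑-P-w m = trans
    (∑-cong (upTo (suc n)) λ r → trans (∑-P (w r m))
      (vectorSeries-w constant-t≈1+u X^N≈0 n 0 r m refl n ℕ.≤-refl))
    (sym (∑ˢ-coefficient (upTo (suc n)) (λ r → window (suc r) m ⊛ H (suc r ℕ.+ m)) n))

  -- With ratio 1 the sum is K for m + 1, namely ∑ X^((m+1)(i+1)); its coefficient counts the ways
  -- to write n = (m+1)(i+1).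
  geometric-coefficient : ∀ m → geometric n S.1# (X ^ˢ suc m) n ≈ [ suc m ∣? n ]
  geometric-coefficient m = begin
    geometric n S.1# (X ^ˢ suc m) n
      ≈⟨ ∑ˢ-coefficient (upTo n) (λ i → (S.1# ^ˢ i) ⊛ ((X ^ˢ suc m) ^ˢ suc i)) n ⟩
    ∑ (upTo n) (λ i → ((S.1# ^ˢ i) ⊛ ((X ^ˢ suc m) ^ˢ suc i)) n)
      ≈⟨ ∑-cong (upTo n) (λ i → trans
           (S.trans (S.*-congʳ {(X ^ˢ suc m) ^ˢ suc i} (1^ i)) (S.trans (S.*-identityˡ ((X ^ˢ suc m) ^ˢ suc i)) (^ˢ-assocʳ X (suc m) (suc i))) n ℕ.≤-refl)
           (X^-coefficient (suc m ℕ.* suc i) n)) ⟩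
    ∑ (upTo n) (λ i → [ suc m ℕ.* suc i ℕ.≟ n ])
      ≈⟨ ∑-multiples n m n≢0 (suc m ∣? n) ⟩
    [ suc m ∣? n ] ∎
    where
    1^ : ∀ i → S.1# ^ˢ i S.≈ S.1#
    1^ zero    m _   = ≈-refl
    1^ (suc i) m m≤n = trans (⊛-identityˡ (S.1# ^ˢ i) m) (1^ i m m≤n)

  D-coefficient-rec : ∀ m → D m n ≈ [ suc m ∣? n ] + t * D (suc m) n
  D-coefficient-rec m = trans (D-rec m (geometric n S.1# (X ^ˢ suc m)) K-eq n ℕ.≤-refl)
    (+-cong (geometric-coefficient m) (constant-⊛ t (D (suc m)) n))
    where
    K-eq : geometric n S.1# (X ^ˢ suc m) S.≈ X ^ˢ suc m S.* (S.1# S.+ geometric n S.1# (X ^ˢ suc m))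
    K-eq = S.trans (geometric-q S.1# m) (S.*-congˡ {X ^ˢ suc m} (S.+-congˡ {S.1#}
      (S.*-identityˡ (geometric n S.1# (X ^ˢ suc m)))))

  k≢0 : ∀ {π} → π ∈ P n → k π ≢ 0
  k≢0 {π} π∈P k≡0 = n≢0 (≡.trans (≡.sym (∈-P⁻ π∈P))
    (≡.trans (weight≡weightFrom π) (weightFrom-0 0 π k≡0)))

  ∑-partitions : ∀ a → ∑ (P n) (λ π → coefficient π * blockSum a π) ≈ ∑ (upTo n) (λ m → a (suc m) * D m n)
  ∑-partitions a = begin
    ∑ (P n) (λ π → coefficient π * blockSum a π)
      -- The ranges are those of `D` and of the recurrence; the surplus index r = n skips the whole
      -- vector and contributes 0.
      ≈⟨ ∑-cong-∈ (P n) (λ {π} π∈P → sym (∑-w (suc n) n a π (ℕ.n≤1+n n) ℕ.≤-refl (k≢0 π∈P))) ⟩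
    ∑ (P n) (λ π → ∑ (upTo (suc n)) (λ r → ∑ (upTo n) (λ m → a (suc m) * w r m π)))
      ≈⟨ ∑-cong (P n) (λ π → ∑-swap (upTo (suc n)) (upTo n) (λ r m → a (suc m) * w r m π)) ⟩
    ∑ (P n) (λ π → ∑ (upTo n) (λ m → ∑ (upTo (suc n)) (λ r → a (suc m) * w r m π)))
      ≈⟨ ∑-swap (P n) (upTo n) (λ π m → ∑ (upTo (suc n)) (λ r → a (suc m) * w r m π)) ⟩
    ∑ (upTo n) (λ m → ∑ (P n) (λ π → ∑ (upTo (suc n)) (λ r → a (suc m) * w r m π)))
      ≈⟨ ∑-cong (upTo n) (λ m → ∑-swap (P n) (upTo (suc n)) (λ π r → a (suc m) * w r m π)) ⟩
    ∑ (upTo n) (λ m → ∑ (upTo (suc n)) (λ r → ∑ (P n) (λ π → a (suc m) * w r m π)))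
      ≈⟨ ∑-cong (upTo n) (λ m → ∑-cong (upTo (suc n)) λ r → sym (*-∑ (P n) (a (suc m)) (w r m))) ⟩
    ∑ (upTo n) (λ m → ∑ (upTo (suc n)) (λ r → a (suc m) * ∑ (P n) (w r m)))
      ≈⟨ ∑-cong (upTo n) (λ m → trans (sym (*-∑ (upTo (suc n)) (a (suc m)) _)) (*-congˡ (∑-P-w m))) ⟩
    ∑ (upTo n) (λ m → a (suc m) * D m n) ∎

  module _ (a τ : ℕ → Carrier) (t^i*τ≈1 : ∀ i → t ^ i * τ i ≈ 1#) where

    -- Turns the quotients tᵈ/tⁱ of the divisor sum into the powers produced by the recurrence.
    t^∸ : ∀ {i d} → i ≤ d → t ^ d * τ i ≈ t ^ (d ∸ i)
    t^∸ {i} {d} i≤d = begin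
      t ^ d * τ i                     ≈⟨ *-congʳ (reflexive (≡.cong (t ^_) (≡.sym (ℕ.m∸n+n≡m i≤d)))) ⟩
      t ^ (d ∸ i ℕ.+ i) * τ i         ≈⟨ *-congʳ (^-homo-* t (d ∸ i) i) ⟩
      t ^ (d ∸ i) * t ^ i * τ i       ≈⟨ trans (*-assoc _ _ _) (*-congˡ (t^i*τ≈1 i)) ⟩
      t ^ (d ∸ i) * 1#                ≈⟨ *-identityʳ _ ⟩
      t ^ (d ∸ i)                     ∎

    divisor-term : ∀ e → t ^ suc e * ∑ [1‥ suc e ] (λ i → a i * τ i)
                       ≈ ∑ (upTo (suc e)) (λ i → a (suc i) * t ^ (e ∸ i))
    divisor-term e = begin
      t ^ suc e * ∑ [1‥ suc e ] (λ i → a i * τ i)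
        ≈⟨ *-congˡ (∑-map suc (upTo (suc e)) _) ⟩
      t ^ suc e * ∑ (upTo (suc e)) (λ i → a (suc i) * τ (suc i))
        ≈⟨ *-∑ (upTo (suc e)) _ _ ⟩
      ∑ (upTo (suc e)) (λ i → t ^ suc e * (a (suc i) * τ (suc i)))
        ≈⟨ ∑-cong-∈ (upTo (suc e)) (λ {i} i∈ → trans
             (solve 3 (λ x y z → x :* (y :* z) := y :* (x :* z)) ≈-refl _ _ _)
             (*-congˡ (t^∸ (∈-upTo⁻ i∈)))) ⟩
      ∑ (upTo (suc e)) (λ i → a (suc i) * t ^ (e ∸ i)) ∎

    partition-identity : ∑ (P n) (λ π → coefficient π * blockSum a π)
                       ≈ ∑ (divisors n) (λ d → t ^ d * ∑ [1‥ d ] (λ i → a i * τ i))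
    partition-identity = begin
      ∑ (P n) (λ π → coefficient π * blockSum a π)
        ≈⟨ ∑-partitions a ⟩
      ∑ (upTo n) (λ m → a (suc m) * D m n)
        ≈⟨ DivisorSums.∑-recurrence R t n (a ∘ suc) (λ e → [ suc e ∣? n ]) (λ m → D m n)
             D-coefficient-rec (D-vanishes n ℕ.≤-refl) ⟩
      ∑ (upTo n) (λ e → [ suc e ∣? n ] * ∑ (upTo (suc e)) (λ i → a (suc i) * t ^ (e ∸ i)))
        ≈⟨ ∑-cong (upTo n) (λ e → *-congˡ (sym (divisor-term e))) ⟩
      ∑ (upTo n) (λ e → [ suc e ∣? n ] * (t ^ suc e * ∑ [1‥ suc e ] (λ i → a i * τ i)))
        ≈⟨ sym (∑-map suc (upTo n) (λ d → [ d ∣? n ] * (t ^ d * ∑ [1‥ d ] (λ i → a i * τ i)))) ⟩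
      ∑ [1‥ n ] (λ d → [ d ∣? n ] * (t ^ d * ∑ [1‥ d ] (λ i → a i * τ i)))
        ≈⟨ sym (∑-filter (_∣? n) [1‥ n ] _) ⟩
      ∑ (divisors n) (λ d → t ^ d * ∑ [1‥ d ] (λ i → a i * τ i)) ∎

-- Specialisation to the complex numbers.

open import Defs

theorem4 : (a : ℕ → ℂ) (t : ℂ) (t#0 : t # 0ℂ) (t#1 : t # 1ℂ) (n : ℕ) → n ≥ 1 →
    ∑[ π ∈ P n ] t ^ (k π ∸ 1) * ((t - 1ℂ) / t [ t#0 ]) ^ (Q π ∸ 1)
                   * (∑[ j ∈ [1‥ s π ] ] a (l π ∸ s π ℕ.+ j))
      ≈ ∑[ d ∈ divisors n ] t ^ d * (∑[ i ∈ [1‥ d ] ] a i / t ^ i [ ^-#0 t#0 i ])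
theorem4 a t t#0 _ n n≥1 =
  -- Here `v` is (t - 1)/t and `τ i` is the inverse of tⁱ. Since `_/_[_]` unfolds to a product with
  -- `_⁻¹[_]`, both sides match definitionally.
  PartitionIdentity.partition-identity ℂ-commutativeRing t (t - 1ℂ) ((t - 1ℂ) / t [ t#0 ]) t≈1+u t*v≈u
    n (ℕ.>⇒≢ n≥1) a (λ i → (t ^ i) ⁻¹[ ^-#0 t#0 i ]) (λ i → ⁻¹-inverseʳ (t ^ i) (^-#0 t#0 i))
  where
  module ℂR = CommutativeRing ℂ-commutativeRing
  open import Relation.Binary.Reasoning.Setoid ℂR.setoid

  t≈1+u : t ≈ 1ℂ + (t - 1ℂ)
  t≈1+u = begin
    t                     ≈⟨ ℂR.+-identityʳ t ⟨
    t + 0ℂ                ≈⟨ ℂR.+-congˡ {t} (ℂR.-‿inverseˡ 1ℂ) ⟨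
    t + (- 1ℂ + 1ℂ)       ≈⟨ ℂR.+-assoc t (- 1ℂ) 1ℂ ⟨
    t - 1ℂ + 1ℂ           ≈⟨ ℂR.+-comm (t - 1ℂ) 1ℂ ⟩
    1ℂ + (t - 1ℂ)         ∎

  t*v≈u : t * ((t - 1ℂ) / t [ t#0 ]) ≈ t - 1ℂ
  t*v≈u = begin
    t * ((t - 1ℂ) * t ⁻¹[ t#0 ])    ≈⟨ ℂR.*-comm t _ ⟩
    (t - 1ℂ) * t ⁻¹[ t#0 ] * t      ≈⟨ ℂR.*-assoc (t - 1ℂ) _ t ⟩
    (t - 1ℂ) * (t ⁻¹[ t#0 ] * t)    ≈⟨ ℂR.*-congˡ {t - 1ℂ} (ℂR.*-comm (t ⁻¹[ t#0 ]) t) ⟩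
    (t - 1ℂ) * (t * t ⁻¹[ t#0 ])    ≈⟨ ℂR.*-congˡ {t - 1ℂ} (⁻¹-inverseʳ t t#0) ⟩
    (t - 1ℂ) * 1ℂ                   ≈⟨ ℂR.*-identityʳ (t - 1ℂ) ⟩
    t - 1ℂ                          ∎
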